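{- Let $k, n, r, s, t$ be nonnegative integers with $k \geq 1$, $n \geq 6$ and $r + s + t = k$. Then $$ gr_{k}(K_{3} : rW_{n}, sC_{n - 1}, tP_{n - 2}) \leq (n - 4)^{2} \cdot 30^{r} \cdot 10^{s} \cdot 2^{t} + k(n - 1). $$
   Context: For $n \geq 4$, the wheel $W_n = K_1 \vee C_{n-1}$ is a cycle on $n-1$ vertices together with one additional vertex adjacent to all cycle vertices; $C_{m}$ is the cycle on $m$ vertices and $P_{m}$ is the path on $m$ vertices. For nonnegative integers $k,n,r,s,t$ with $k\ge 1$, $n \geq 6$ and $r+s+t=k$, $gr_{k}(K_{3} : rW_{n}, sC_{n - 1}, tP_{n - 2})$ denotes the minimum integer $N$ such that every coloring of the edges of $K_N$ with colors $1,\dots,k$ contains one of: a rainbow triangle (three edges of distinct colors), a monochromatic copy of $W_n$ in one of the colors $1,\dots,r$, a monochromatic copy of $C_{n-1}$ in one of the colors $r+1,\dots,r+s$, or a monochromatic copy of $P_{n-2}$ in one of the colors $r+s+1,\dots,k$. -}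

module Defs where

open import Data.Nat using (ℕ; zero; suc; _+_; _*_; _∸_; _^_; _≤_; _<_)
open import Data.Fin using (Fin; toℕ; zero; suc)
open import Data.Product using (Σ; ∃; _×_; _,_)
open import Data.Sum using (_⊎_)
open import Relation.Binary.PropositionalEquality using (_≡_; _≢_)
open import Function.Definitions using (Injective)

Graph : ℕ → Set₁
Graph m = Fin m → Fin m → Set

Path : (m : ℕ) → Graph m
Path m u v = (toℕ v ≡ suc (toℕ u)) ⊎ (toℕ u ≡ suc (toℕ v))

-- Cycle C_m : path plus the edge {0, m-1}  (used only with m ≥ 3).
Cycle : (m : ℕ) → Graph m
Cycle m u v = Path m u v
            ⊎ ((toℕ u ≡ 0 × suc (toℕ v) ≡ m) ⊎ (toℕ v ≡ 0 × suc (toℕ u) ≡ m))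

-- Wheel W_n = K_1 ∨ C_{n-1}: vertex 0 is the hub, vertices suc i (i : Fin (n-1))
-- form the cycle C_{n-1}.  (Used only with n ≥ 4.)
Wheel : (n : ℕ) → Graph (suc n)  -- Wheel n is W_{n+1}; see WheelG below
Wheel n zero    zero    = Data.Empty.⊥ where import Data.Empty
Wheel n zero    (suc v) = Data.Unit.⊤ where import Data.Unit
Wheel n (suc u) zero    = Data.Unit.⊤ where import Data.Unit
Wheel n (suc u) (suc v) = Cycle n u v

W : (n : ℕ) → Graph n
W zero    = λ ()
W (suc n) = Wheel n

-- An edge colouring of the complete graph K_N with colours Fin k.
-- Only values c u v with u ≢ v are relevant; we require symmetry.
Colouring : ℕ → ℕ → Set
Colouring N k = Σ (Fin N → Fin N → Fin k) λ c → ∀ u v → c u v ≡ c v u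

RainbowTriangle : ∀ {N k} → (Fin N → Fin N → Fin k) → Set
RainbowTriangle {N} c = Σ (Fin N) λ x → Σ (Fin N) λ y → Σ (Fin N) λ z →
  x ≢ y × y ≢ z × x ≢ z ×
  c x y ≢ c y z × c y z ≢ c x z × c x y ≢ c x z

MonoCopy : ∀ {N k m} → (Fin N → Fin N → Fin k) → Fin k → Graph m → Set
MonoCopy {N} {k} {m} c i G = Σ (Fin m → Fin N) λ f →
  Injective _≡_ _≡_ f × (∀ u v → G u v → c (f u) (f v) ≡ i)

Contains : ∀ {N k} → (Fin N → Fin N → Fin k) → ℕ → ℕ → ℕ → Fin k → Set
Contains c n r s i =
    (toℕ i < r × MonoCopy c i (W n))
  ⊎ ((r ≤ toℕ i × toℕ i < r + s) × MonoCopy c i (Cycle (n ∸ 1)))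
  ⊎ (r + s ≤ toℕ i × MonoCopy c i (Path (n ∸ 2)))

GRProperty : (k n r s N : ℕ) → Set
GRProperty k n r s N = (col : Colouring N k) →
  let c = Data.Product.proj₁ col in
  RainbowTriangle c ⊎ (∃ λ (i : Fin k) → Contains c n r s i)
  where import Data.Product

{-# OPTIONS --safe #-}
-- Call a vertex set with its remaining forbidden graphs a state. A vertex joined to a set X in
-- one colour i weakens what X must avoid in colour i: W_n becomes C_{n-1}, and C_{n-1} becomes
-- P_{n-2}; many vertices joined to X in a colour i of path type shorten the path to be avoided.
-- The potential (n-4)² · ∏ weights + Σ budgets, with weights 30, 10, 2 for wheel, cycle, path,
-- controls the size of a set by induction.
--
-- By Gallai's theorem every vertex x lies in a proper module X whose edges to the outside have at
-- most two colours a, b and depend only on the outer endpoint; so the set splits as X ⊔ A ⊔ B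
-- with X–A of colour a and X–B of colour b. If a and b are of wheel or cycle type, the weights of
-- the weakened states of X, A, B add up to less than the original one. If only a is, then either
-- a path of colour b is found greedily, or some x has small B and the same count applies. If both
-- are of path type, a module of at least n-3 vertices absorbs A and B into the budgets, and
-- otherwise all modules have at most n-4 vertices, so a transversal of them is a large complete
-- graph in two colours, which contains a long monochromatic path.
module Submission where

open import Defs
open import Data.Nat using (ℕ; zero; suc; _+_; _*_; _∸_; _^_; _⊓_; _≤_; _<_; z≤n; s≤s; _≤?_; _<?_)
open import Data.Nat.Properties
open import Data.Nat.Induction using (<-wellFounded)
open import Data.Nat.Tactic.RingSolver using (solve-∀)
open import Data.Fin using (Fin; zero; suc; toℕ; fromℕ<; reduce≥)
import Data.Fin.Properties as Fin
open import Data.List using (List; []; _∷_; length; filter; lookup; _++_; allFin)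
open import Data.List.Properties using (filter-notAll; length-filter; length-++; length-tabulate)
open import Data.List.Membership.Propositional using (_∈_; _∉_; find; lose)
open import Data.List.Membership.Propositional.Properties using (∈-filter⁺; ∈-filter⁻; ∈-lookup; ∈-++⁺ˡ; ∈-++⁺ʳ)
open import Data.List.Relation.Binary.Permutation.Propositional using (_↭_; ↭-refl; ↭-sym; ↭-trans; prep; ↭⇒↭ₛ)
open import Data.List.Relation.Binary.Permutation.Propositional.Properties using (shift; ∈-resp-↭; ↭-length)
import Data.List.Relation.Binary.Permutation.Setoid.Properties as Permₛ
open import Data.List.Relation.Unary.Any using (here; there; any?)
open import Data.List.Relation.Unary.All as All using (All; []; _∷_)
open import Data.List.Relation.Unary.All.Properties using (¬Any⇒All¬)
open import Data.List.Relation.Unary.AllPairs using ([]; _∷_)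
open import Data.List.Relation.Unary.Linked as Linked using (Linked; []; [-]; _∷_)
open import Data.List.Relation.Unary.Unique.Propositional using (Unique)
open import Data.List.Relation.Unary.Unique.Propositional.Properties as Uniq using (Unique[x∷xs]⇒x∉xs)
open import Data.Product using (Σ; ∃; _×_; _,_; proj₁; proj₂)
open import Data.Sum using (_⊎_; inj₁; inj₂; [_,_]′)
open import Data.Vec as Vec using (Vec; []; _∷_; _[_]≔_)
open import Data.Vec.Properties using (lookup∘update; lookup∘update′; lookup-++-<; lookup-++-≥; lookup-replicate)
open import Function using (_∘_; id)
open import Function.Definitions using (Injective)
open import Induction.WellFounded using (Acc; acc)
open import Relation.Nullary using (¬_; Dec; yes; no; contradiction)
open import Relation.Nullary.Decidable using (¬?; _×-dec_; _⊎-dec_; decidable-stable)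
open import Relation.Unary using (Decidable)
open import Relation.Binary.PropositionalEquality

-- Searching, filtering and counting in finite lists.

search : ∀ {A : Set} {Q : A → Set} → Decidable Q → (xs : List A) →
  (∃ λ x → x ∈ xs × Q x) ⊎ (∀ {x} → x ∈ xs → ¬ Q x)
search Q? xs with any? Q? xs
... | yes q = inj₁ (find q)
... | no ¬q = inj₂ λ x∈ qx → ¬q (lose x∈ qx)

length-filter-split : ∀ {A : Set} {Q : A → Set} (Q? : Decidable Q) (xs : List A) →
  length (filter Q? xs) + length (filter (¬? ∘ Q?) xs) ≡ length xs
length-filter-split Q? [] = refl
length-filter-split Q? (x ∷ xs) with Q? x
... | yes _ = cong suc (length-filter-split Q? xs)
... | no  _ = trans (+-suc _ _) (cong suc (length-filter-split Q? xs))

filter-mono-≤ : ∀ {A : Set} {Q R : A → Set} (Q? : Decidable Q) (R? : Decidable R) →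
  (∀ {x} → Q x → R x) → (xs : List A) → length (filter Q? xs) ≤ length (filter R? xs)
filter-mono-≤ Q? R? Q⇒R [] = z≤n
filter-mono-≤ Q? R? Q⇒R (x ∷ xs) with Q? x | R? x
... | yes q | yes _ = s≤s (filter-mono-≤ Q? R? Q⇒R xs)
... | yes q | no ¬r = contradiction (Q⇒R q) ¬r
... | no _  | yes _ = m≤n⇒m≤1+n (filter-mono-≤ Q? R? Q⇒R xs)
... | no _  | no _  = filter-mono-≤ Q? R? Q⇒R xs

filter-mono-< : ∀ {A : Set} {Q R : A → Set} (Q? : Decidable Q) (R? : Decidable R) →
  (∀ {x} → Q x → R x) → ∀ {x} {xs : List A} → x ∈ xs → R x → ¬ Q x →
  length (filter Q? xs) < length (filter R? xs)
filter-mono-< Q? R? Q⇒R {xs = x ∷ xs} (here refl) r ¬q with Q? x | R? x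
... | yes q | _     = contradiction q ¬q
... | no _  | yes _ = s≤s (filter-mono-≤ Q? R? Q⇒R xs)
... | no _  | no ¬r = contradiction r ¬r
filter-mono-< Q? R? Q⇒R {xs = y ∷ xs} (there x∈) r ¬q with Q? y | R? y
... | yes q | yes _ = s≤s (filter-mono-< Q? R? Q⇒R x∈ r ¬q)
... | yes q | no ¬r = contradiction (Q⇒R q) ¬r
... | no _  | yes _ = m≤n⇒m≤1+n (filter-mono-< Q? R? Q⇒R x∈ r ¬q)
... | no _  | no _  = filter-mono-< Q? R? Q⇒R x∈ r ¬q

module _ {N : ℕ} where

  Unique-⊆⇒length≤ : {xs ys : List (Fin N)} → Unique xs → (∀ {x} → x ∈ xs → x ∈ ys) →
    length xs ≤ length ys
  Unique-⊆⇒length≤ {[]} u xs⊆ys = z≤n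
  Unique-⊆⇒length≤ {x ∷ xs} {ys} u@(_ ∷ uxs) xs⊆ys = ≤-trans
    (s≤s (Unique-⊆⇒length≤ uxs λ {y} y∈ → ∈-filter⁺ ≢x? (xs⊆ys (there y∈))
       λ { refl → Unique[x∷xs]⇒x∉xs u y∈ }))
    (filter-notAll ≢x? ys (lose (xs⊆ys (here refl)) λ x≢x → x≢x refl))
    where
    ≢x? : Decidable (_≢ x)
    ≢x? y = ¬? (y Fin.≟ x)

  fresh : {xs ys : List (Fin N)} → Unique xs → length ys < length xs → ∃ λ x → x ∈ xs × x ∉ ys
  fresh {xs} {ys} u lt with search (λ x → ¬? (any? (x Fin.≟_) ys)) xs
  ... | inj₁ r = r
  ... | inj₂ none = contradiction lt (≤⇒≯ (Unique-⊆⇒length≤ u λ {x} x∈ →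
          decidable-stable (any? (x Fin.≟_) ys) (none x∈)))

-- Gallai's theorem: two-coloured cuts and modules in the absence of rainbow triangles.

module Gallai {N k : ℕ} (c : Fin N → Fin N → Fin k) (c-sym : ∀ u v → c u v ≡ c v u)
              (¬rainbow : ¬ RainbowTriangle c) where

  V : Set
  V = Fin N

  _∈₂_,_ : Fin k → Fin k → Fin k → Set
  e ∈₂ a , b = e ≡ a ⊎ e ≡ b

  _∈₂?_,_ : ∀ e a b → Dec (e ∈₂ a , b)
  e ∈₂? a , b = (e Fin.≟ a) ⊎-dec (e Fin.≟ b)

  -- Degenerate triples satisfy this too, so vertices need not be distinct.
  third : ∀ {x y z p q} → c x y ≡ p → c x z ≡ q → p ≢ q → c y z ∈₂ p , q
  third {x} {y} {z} refl refl p≢q with c y z Fin.≟ c x y | c y z Fin.≟ c x z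
  ... | yes e | _     = inj₁ e
  ... | no _  | yes e = inj₂ e
  ... | no d  | no d′ = contradiction
    (x , y , z , (λ { refl → d′ refl }) , (λ { refl → p≢q refl }) ,
      (λ { refl → d (c-sym y z) }) , (λ e → d (sym e)) , d′ , p≢q) ¬rainbow

  -- `Side` is a predicate on all vertices that is constrained only on `S`. The colours `a` and `b`
  -- may coincide, which covers cuts in a single colour.
  record Cut (S : List V) (a b : Fin k) : Set₁ where
    field
      Side    : V → Set
      side?   : Decidable Side
      inner   : ∃ λ x → x ∈ S × Side x
      outer   : ∃ λ y → y ∈ S × ¬ Side y
      cross   : ∀ {u w} → u ∈ S → w ∈ S → Side u → ¬ Side w → c u w ∈₂ a , b

  open Cut

  record ModuleAt (S : List V) (a b : Fin k) (x : V) : Set₁ where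
    field
      cut         : Cut S a b
      centre      : Side cut x
      homogeneous : ∀ {u w} → u ∈ S → w ∈ S → Side cut u → ¬ Side cut w → c u w ≡ c x w

  flip : ∀ {S a b} → Cut S a b → Cut S a b
  flip C .Side v = ¬ Side C v
  flip C .side? v = ¬? (side? C v)
  flip C .inner = outer C
  flip C .outer = let (x , x∈ , sx) = inner C in x , x∈ , λ ¬s → ¬s sx
  flip C .cross {u} {w} u∈ w∈ ¬su ¬¬sw rewrite c-sym u w =
    cross C w∈ u∈ (decidable-stable (side? C w) ¬¬sw) ¬su

  swap : ∀ {S a b} → Cut S a b → Cut S b a
  swap C .Side = Side C
  swap C .side? = side? C
  swap C .inner = inner C
  swap C .outer = outer C
  swap C .cross u∈ w∈ su ¬sw = [ inj₂ , inj₁ ]′ (cross C u∈ w∈ su ¬sw)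

  -- If an outside vertex y sees two colours on a side, the side splits by colour to y,
  -- and the edges between the two halves again carry only those two colours.
  shrink : ∀ {S a b x} (C : Cut S a b) → x ∈ S → Side C x →
    Acc _<_ (length (filter (side? C) S)) → ModuleAt S a b x
  shrink {S} {a} {b} {x} C x∈ sx (acc rs)
    with search (λ y → ¬? (side? C y) ×-dec any? (λ u → side? C u ×-dec ¬? (c u y Fin.≟ c x y)) S) S
  ... | inj₂ none = record { cut = C ; centre = sx ; homogeneous = λ {u} {w} u∈ w∈ su ¬sw →
          decidable-stable (c u w Fin.≟ c x w) λ d → none w∈ (¬sw , lose u∈ (su , d)) }
  ... | inj₁ (y , y∈ , ¬sy , split) with find split
  ... | u , u∈ , su , d = shrink C′ x∈ (sx , refl)
          (rs (filter-mono-< (side? C′) (side? C) proj₁ u∈ su (d ∘ proj₂)))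
    where
    C′ : Cut S a b
    C′ .Side z = Side C z × c z y ≡ c x y
    C′ .side? z = side? C z ×-dec (c z y Fin.≟ c x y)
    C′ .inner = x , x∈ , sx , refl
    C′ .outer = y , y∈ , ¬sy ∘ proj₁
    C′ .cross {z} {w} z∈ w∈ (sz , zy) ¬sw with side? C w
    ... | no ¬s = cross C z∈ w∈ sz ¬s
    ... | yes sw with third {y} {z} {w} (c-sym y z) (c-sym y w)
                        (λ e → ¬sw (sw , trans (sym e) zy))
    ... | inj₁ e rewrite e = cross C z∈ y∈ sz ¬sy
    ... | inj₂ e rewrite e = cross C w∈ y∈ sw ¬sy

  -- Either side of a cut can be shrunk, so every vertex of `S` lies in a module, and all these
  -- modules use the same two colours.
  moduleAt : ∀ {S a b x} → Cut S a b → x ∈ S → ModuleAt S a b x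
  moduleAt {x = x} C x∈ with side? C x
  ... | yes sx = shrink C x∈ sx (<-wellFounded _)
  ... | no ¬sx = shrink (flip C) x∈ ¬sx (<-wellFounded _)

  common : ∀ {e p q r} → e ∈₂ p , q → e ∈₂ p , r → q ≢ r → e ≡ p
  common (inj₁ e) _        _   = e
  common (inj₂ _) (inj₁ e) _   = e
  common (inj₂ e) (inj₂ f) q≢r = contradiction (trans (sym e) f) q≢r

  swap₂ : ∀ {e p q} → e ∈₂ p , q → e ∈₂ q , p
  swap₂ = [ inj₂ , inj₁ ]′

  -- The new vertex `v` joins the complement of `Q`. Since `Q` may happen to hold at `v`, the side
  -- excludes `v` explicitly.
  carve : ∀ {S v a b} {Q : V → Set} → v ∉ S → Decidable Q → (∃ λ y → y ∈ S × Q y) →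
    (∀ {q} → q ∈ S → Q q → c v q ∈₂ a , b) →
    (∀ {q w} → q ∈ S → w ∈ S → Q q → ¬ Q w → c q w ∈₂ a , b) → Cut (v ∷ S) a b
  carve {v = v} {Q = Q} v∉S Q? (y , y∈ , qy) toV toRest = record
    { Side  = λ u → u ≢ v × Q u
    ; side? = λ u → ¬? (u Fin.≟ v) ×-dec Q? u
    ; inner = y , there y∈ , (λ { refl → v∉S y∈ }) , qy
    ; outer = v , here refl , λ (v≢v , _) → v≢v refl
    ; cross = cross′
    }
    where
    cross′ : ∀ {u w} → u ∈ v ∷ _ → w ∈ v ∷ _ → u ≢ v × Q u → ¬ (w ≢ v × Q w) → c u w ∈₂ _ , _
    cross′ (here u≡v) _ (u≢v , _) _ = contradiction u≡v u≢v
    cross′ {u} (there u∈) (here refl) (_ , qu) _ rewrite c-sym u v = toV u∈ qu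
    cross′ (there u∈) (there w∈) (_ , qu) ¬qw =
      toRest u∈ w∈ qu λ qw → ¬qw ((λ { refl → v∉S w∈ }) , qw)

  -- Both sides of the cut send v an edge of one further colour g. Up to the names of a and b,
  -- v, or the a-neighbours, or the b-neighbours of v on the outer side can then be cut off.
  recut : ∀ {S v a b x x₀ y₀ g} → v ∉ S → (M : ModuleAt S a b x) (let open ModuleAt M) → x ∈ S →
    x₀ ∈ S → Side cut x₀ → c v x₀ ≡ g → y₀ ∈ S → ¬ Side cut y₀ → c v y₀ ≡ g →
    g ≢ a → g ≢ b → c x y₀ ≡ a → ∃ λ a′ → ∃ λ b′ → Cut (v ∷ S) a′ b′
  recut {S} {v} {a} {b} {x} {x₀} {y₀} {g} v∉S M x∈ x₀∈ sx₀ vx₀ y₀∈ ¬sy₀ vy₀ g≢a g≢b κy₀ = result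
    where
    open ModuleAt M

    s? : Decidable (Side cut)
    s? = side? cut

    -- For an outer vertex `w`, κ stands for `c x w`, the colour in which the whole module sees `w`.
    κ-range : ∀ {w} → w ∈ S → ¬ Side cut w → c x w ∈₂ a , b
    κ-range w∈ ¬sw = cross cut x∈ w∈ centre ¬sw

    inside : ∀ {u} → u ∈ S → Side cut u → c v u ∈₂ g , a
    inside {u} u∈ su = third {y₀} (trans (c-sym y₀ v) vy₀)
      (trans (c-sym y₀ u) (trans (homogeneous u∈ y₀∈ su ¬sy₀) κy₀)) g≢a

    outside : ∀ {w} → w ∈ S → ¬ Side cut w → c v w ∈₂ g , c x w
    outside {w} w∈ ¬sw = third {x₀} (trans (c-sym x₀ v) vx₀) (homogeneous x₀∈ w∈ sx₀ ¬sw)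
      λ g≡κ → [ (λ κ≡a → g≢a (trans g≡κ κ≡a)) , (λ κ≡b → g≢b (trans g≡κ κ≡b)) ]′ (κ-range w∈ ¬sw)

    κ-of : ∀ {w e} → w ∈ S → ¬ Side cut w → c v w ≡ e → g ≢ e → c x w ≡ e
    κ-of w∈ ¬sw vw g≢e with outside w∈ ¬sw
    ... | inj₁ vw′ = contradiction (trans (sym vw′) vw) g≢e
    ... | inj₂ vw′ = trans (sym vw′) vw

    Outer : Fin k → V → Set
    Outer e w = ¬ Side cut w × c v w ≡ e

    outer? : ∀ e → Decidable (Outer e)
    outer? e w = ¬? (s? w) ×-dec (c v w Fin.≟ e)

    cut-v : ∀ {p q} → (∀ {u} → u ∈ S → c v u ∈₂ p , q) → Cut (v ∷ S) p q
    cut-v vS = carve {Q = _∈ S} v∉S (λ u → any? (u Fin.≟_) S) (x , x∈ , x∈) (λ u∈ _ → vS u∈)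
      λ _ w∈ _ w∉ → contradiction w∈ w∉

    module _ (a≢b : a ≢ b) where

      differ : ∀ {w z} → c x w ≡ a → c x z ≡ b → c w z ∈₂ a , b
      differ κw κz = third {x} κw κz a≢b

      -- The pair `y₃`, `y₄` prevents `Outer b` from being cut off in the colours `a` and `b`. This
      -- forces the module to see both vertices in colour `b`, and `v y₄`, `y₃ y₄` and all edges
      -- from `v` to the module to have colour `g`.
      module _ {y₃ y₄} (y₃∈ : y₃ ∈ S) (o₃ : Outer b y₃) (y₄∈ : y₄ ∈ S) (¬o₄ : ¬ Outer b y₄)
               (¬ab : ¬ c y₃ y₄ ∈₂ a , b) where

        κ₃ : c x y₃ ≡ b
        κ₃ = κ-of y₃∈ (proj₁ o₃) (proj₂ o₃) g≢b

        ¬s₄ : ¬ Side cut y₄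
        ¬s₄ s₄ = ¬ab (inj₂ (trans (c-sym y₃ y₄) (trans (homogeneous y₄∈ y₃∈ s₄ (proj₁ o₃)) κ₃)))

        κ₄ : c x y₄ ≡ b
        κ₄ with κ-range y₄∈ ¬s₄
        ... | inj₂ e = e
        ... | inj₁ e = contradiction
          (subst (_∈₂ a , b) (c-sym y₄ y₃) (differ e κ₃)) ¬ab

        vy₄ : c v y₄ ≡ g
        vy₄ with outside y₄∈ ¬s₄
        ... | inj₁ e = e
        ... | inj₂ e = contradiction (¬s₄ , trans e κ₄) ¬o₄

        y₃y₄ : c y₃ y₄ ≡ g
        y₃y₄ with third {v} (proj₂ o₃) vy₄ (g≢b ∘ sym)
        ... | inj₁ e = contradiction (inj₂ e) ¬ab
        ... | inj₂ e = e

        inside-g : ∀ {u} → u ∈ S → Side cut u → c v u ≡ g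
        inside-g {u} u∈ su = common (inside u∈ su)
          (third {y₄} (trans (c-sym y₄ v) vy₄)
            (trans (c-sym y₄ u) (trans (homogeneous u∈ y₄∈ su ¬s₄) κ₄)) g≢b) a≢b

        toRest-a : ∀ {q w} → q ∈ S → w ∈ S → Outer a q → ¬ Outer a w → c q w ∈₂ a , b
        toRest-a {q} {w} q∈ w∈ (¬sq , vq) ¬ow with κ-of q∈ ¬sq vq g≢a | s? w
        ... | κq | yes sw = inj₁ (trans (c-sym q w) (trans (homogeneous w∈ q∈ sw ¬sq) κq))
        ... | κq | no ¬sw with κ-range w∈ ¬sw
        ... | inj₂ κw = differ κq κw
        -- The module sees `q` and `w` in the same colour, so a triangle with `x` does not restrict
        -- `c q w`. A triangle with `y₄` does: `y₄` sends `a` to `q` and `b` to `w`.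
        ... | inj₁ κw = third {y₄} y₄q y₄w a≢b
          where
          vw : c v w ≡ g
          vw with outside w∈ ¬sw
          ... | inj₁ e = e
          ... | inj₂ e = contradiction (¬sw , trans e κw) ¬ow

          y₃w : c y₃ w ≡ b
          y₃w = common (third {v} (proj₂ o₃) vw (g≢b ∘ sym))
            (swap₂ (subst (_∈₂ a , b) (c-sym w y₃) (differ κw κ₃))) g≢a

          y₄w : c y₄ w ≡ b
          y₄w = trans (c-sym y₄ w) (common (third {y₃} y₃w y₃y₄ (g≢b ∘ sym)) (swap₂ (differ κw κ₄)) g≢a)

          y₄q : c y₄ q ≡ a
          y₄q = trans (c-sym y₄ q) (common (third {v} vq vy₄ (g≢a ∘ sym)) (differ κq κ₄) g≢b)

        resolve : ∃ λ a′ → ∃ λ b′ → Cut (v ∷ S) a′ b′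
        resolve with search (outer? a) S
        ... | inj₁ o₅ = a , b , carve v∉S (outer? a) o₅ (λ _ (_ , vq) → inj₁ vq) toRest-a
        ... | inj₂ none = g , b , cut-v vS
          where
          vS : ∀ {u} → u ∈ S → c v u ∈₂ g , b
          vS {u} u∈ with s? u
          ... | yes su = inj₁ (inside-g u∈ su)
          ... | no ¬su with outside u∈ ¬su | κ-range u∈ ¬su
          ... | inj₁ e | _      = inj₁ e
          ... | inj₂ e | inj₁ f = contradiction (¬su , trans e f) (none u∈)
          ... | inj₂ e | inj₂ f = inj₂ (trans e f)

    result : ∃ λ a′ → ∃ λ b′ → Cut (v ∷ S) a′ b′
    -- Cuts are tried in turn: `v` alone with colours `g`, `a`; then `Outer b` with colours `a`,
    -- `b`; if both fail, `resolve` takes `Outer a`, or `v` alone with colours `g`, `b`.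
    result with search (λ w → ¬? (s? w) ×-dec ¬? (c v w ∈₂? g , a)) S
    ... | inj₂ none = g , a , cut-v λ {u} u∈ → decidable-stable (c v u ∈₂? g , a) λ ¬ga →
            none u∈ ((λ su → ¬ga (inside u∈ su)) , ¬ga)
    ... | inj₁ (y₁ , y₁∈ , ¬s₁ , ¬ga)
      with search (λ q → outer? b q ×-dec
                     any? (λ w → ¬? (outer? b w) ×-dec ¬? (c q w ∈₂? a , b)) S) S
    ...   | inj₂ none = a , b , carve v∉S (outer? b) (y₁ , y₁∈ , ¬s₁ , vy₁) (λ _ (_ , vq) → inj₂ vq)
              λ {q} {w} q∈ w∈ oq ¬ow → decidable-stable (c q w ∈₂? a , b) λ ¬ab →
                none q∈ (oq , lose w∈ (¬ow , ¬ab))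
      where
      vy₁ : c v y₁ ≡ b
      vy₁ with outside y₁∈ ¬s₁ | κ-range y₁∈ ¬s₁
      ... | inj₁ e | _      = contradiction (inj₁ e) ¬ga
      ... | inj₂ e | inj₁ f = contradiction (inj₂ (trans e f)) ¬ga
      ... | inj₂ e | inj₂ f = trans e f
    ...   | inj₁ (y₃ , y₃∈ , o₃ , bad) with find bad
    ...     | y₄ , y₄∈ , ¬o₄ , ¬ab = resolve a≢b y₃∈ o₃ y₄∈ ¬o₄ ¬ab
      where
      a≢b : a ≢ b
      a≢b refl with outside y₁∈ ¬s₁ | κ-range y₁∈ ¬s₁
      ... | inj₁ e | _      = contradiction (inj₁ e) ¬ga
      ... | inj₂ e | inj₁ f = contradiction (inj₂ (trans e f)) ¬ga
      ... | inj₂ e | inj₂ f = contradiction (inj₂ (trans e f)) ¬ga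

  swapM : ∀ {S a b x} → ModuleAt S a b x → ModuleAt S b a x
  swapM M = record { cut = swap cut ; centre = centre ; homogeneous = homogeneous }
    where open ModuleAt M

  -- If `v` sends only `a` and `b` to one side, it can be placed on the other. Otherwise it sends a
  -- further colour to each side, and the two further colours agree because the edge between their
  -- endpoints has colour `a` or `b`. The cut is first shrunk to a module since `recut` relies on
  -- homogeneity.
  extendCut : ∀ {S v a b} → v ∉ S → Cut S a b → ∃ λ a′ → ∃ λ b′ → Cut (v ∷ S) a′ b′
  extendCut {S} {v} {a} {b} v∉S C = result
    where
    x = proj₁ (inner C)
    x∈ = proj₁ (proj₂ (inner C))
    M : ModuleAt S a b x
    M = moduleAt C x∈
    open ModuleAt M

    result : ∃ λ a′ → ∃ λ b′ → Cut (v ∷ S) a′ b′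
    result with search (λ u → side? cut u ×-dec ¬? (c v u ∈₂? a , b)) S
    ... | inj₂ none = a , b , carve v∉S (side? cut) (inner cut)
            (λ {q} q∈ sq → decidable-stable (c v q ∈₂? a , b) λ ¬ab → none q∈ (sq , ¬ab)) (cross cut)
    ... | inj₁ (x₀ , x₀∈ , sx₀ , ¬ab₀)
      with search (λ u → ¬? (side? cut u) ×-dec ¬? (c v u ∈₂? a , b)) S
    ...   | inj₂ none = a , b , carve v∉S (side? (flip cut)) (outer cut)
              (λ {q} q∈ sq → decidable-stable (c v q ∈₂? a , b) λ ¬ab → none q∈ (sq , ¬ab))
              (cross (flip cut))
    ...   | inj₁ (y₀ , y₀∈ , ¬sy₀ , ¬ab₁) with vy₀ | cross cut x∈ y₀∈ centre ¬sy₀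
      where
      vy₀ : c v y₀ ≡ c v x₀
      vy₀ with c v y₀ Fin.≟ c v x₀
      ... | yes e = e
      ... | no d with third {v} {y₀} {x₀} refl refl d
                    | subst (_∈₂ a , b) (c-sym x₀ y₀) (cross cut x₀∈ y₀∈ sx₀ ¬sy₀)
      ... | inj₁ e | ab = contradiction (subst (_∈₂ a , b) e ab) ¬ab₁
      ... | inj₂ e | ab = contradiction (subst (_∈₂ a , b) e ab) ¬ab₀
    ... | vy₀ | inj₁ κ = recut v∉S M x∈ x₀∈ sx₀ refl y₀∈ ¬sy₀ vy₀ (¬ab₀ ∘ inj₁) (¬ab₀ ∘ inj₂) κ
    ... | vy₀ | inj₂ κ =
          recut v∉S (swapM M) x∈ x₀∈ sx₀ refl y₀∈ ¬sy₀ vy₀ (¬ab₀ ∘ inj₂) (¬ab₀ ∘ inj₁) κ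

  -- Vertices are added one at a time to a single edge, whose colour serves as both `a` and `b`.
  gallaiCut : ∀ {S} → Unique S → 2 ≤ length S → ∃ λ a → ∃ λ b → Cut S a b
  gallaiCut {u ∷ w ∷ []} U _ = c u w , c u w ,
    carve {Q = _≡ w} (Unique[x∷xs]⇒x∉xs U) (Fin._≟ w) (w , here refl , refl)
      (λ { _ refl → inj₁ refl }) λ { _ (here refl) _ ¬q → contradiction refl ¬q }
  gallaiCut {u ∷ w ∷ z ∷ S} U@(_ ∷ U′) _ =
    let (_ , _ , C) = gallaiCut U′ (s≤s (s≤s z≤n)) in extendCut (Unique[x∷xs]⇒x∉xs U) C
  gallaiCut {_ ∷ []} _ (s≤s ())

-- Duplicate-free and linked lists as injective maps.

Unique-++⁻ : ∀ {A : Set} (xs : List A) {ys} → Unique (xs ++ ys) → Unique xs × Unique ys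
Unique-++⁻ [] u = [] , u
Unique-++⁻ (x ∷ xs) (x∉ ∷ u) =
  let (uxs , uys) = Unique-++⁻ xs u in
  All.tabulate (λ y∈ → All.lookup x∉ (∈-++⁺ˡ y∈)) ∷ uxs , uys

lookup-injective : ∀ {A : Set} {xs : List A} → Unique xs → Injective _≡_ _≡_ (lookup xs)
lookup-injective {xs = _ ∷ _} u {zero} {zero} _ = refl
lookup-injective {xs = x ∷ xs} u {zero} {suc j} e =
  contradiction (subst (_∈ xs) (sym e) (∈-lookup j)) (Unique[x∷xs]⇒x∉xs u)
lookup-injective {xs = x ∷ xs} u {suc i} {zero} e =
  contradiction (subst (_∈ xs) e (∈-lookup i)) (Unique[x∷xs]⇒x∉xs u)
lookup-injective {xs = _ ∷ _} (_ ∷ u) {suc i} {suc j} e = cong suc (lookup-injective u e)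

lookup-Linked : ∀ {A : Set} {R : A → A → Set} {xs : List A} → Linked R xs →
  ∀ i j → toℕ j ≡ suc (toℕ i) → R (lookup xs i) (lookup xs j)
lookup-Linked (r ∷ _)  zero    (suc zero) _ = r
lookup-Linked (_ ∷ rs) (suc i) (suc j)    e = lookup-Linked rs i j (suc-injective e)
lookup-Linked (_ ∷ _)  zero    (suc (suc _)) ()
lookup-Linked [-]      zero    zero ()

-- Building monochromatic paths, cycles and wheels.

module Copies {N k : ℕ} (c : Fin N → Fin N → Fin k) (c-sym : ∀ u v → c u v ≡ c v u) where

  V : Set
  V = Fin N

  Copy : ∀ {m} → Fin k → List V → Graph m → Set
  Copy i S H = Σ (MonoCopy c i H) λ (f , _) → ∀ u → f u ∈ S

  -- Paths are kept as lists because all constructions prolong them at the head; `pathCopy` turns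
  -- the result into an embedding.
  record PathIn (S : List V) (i : Fin k) (m : ℕ) : Set where
    constructor mkPath
    field
      vertices : List V
      linked   : Linked (λ u v → c u v ≡ i) vertices
      distinct : Unique vertices
      within   : All (_∈ S) vertices
      size     : length vertices ≡ m

  open PathIn

  pathCopy : ∀ {S i m} → PathIn S i m → Copy i S (Path m)
  pathCopy {i = i} (mkPath q lk u w refl) = (lookup q , lookup-injective u , edge) , λ j → All.lookup w (∈-lookup j)
    where
    edge : ∀ x y → Path (length q) x y → c (lookup q x) (lookup q y) ≡ i
    edge x y (inj₁ e) = lookup-Linked lk x y e
    edge x y (inj₂ e) = trans (c-sym _ _) (lookup-Linked lk y x e)

  shorten : ∀ {S i m l} → l ≤ m → PathIn S i m → PathIn S i l
  shorten {m = zero} z≤n P = P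
  shorten {m = suc m} {l} l≤ P@(mkPath (_ ∷ _) lk (_ ∷ u) (_ ∷ w) s) with l ≤? m
  ... | yes l≤m = shorten l≤m (mkPath _ (Linked.tail lk) u w (suc-injective s))
  ... | no l≰m = subst (PathIn _ _) (≤-antisym (≰⇒> l≰m) l≤) P

  enlarge : ∀ {S S′ i m} → (∀ {x} → x ∈ S → x ∈ S′) → PathIn S i m → PathIn S′ i m
  enlarge S⊆S′ (mkPath q lk u w s) = mkPath q lk u (All.map S⊆S′ w) s

  module Cone {S X : List V} {t : V} {i : Fin k} (X⊆S : ∀ {x} → x ∈ X → x ∈ S)
              (t∈S : t ∈ S) (t∉X : t ∉ X) (t-X : ∀ {x} → x ∈ X → c t x ≡ i) where

    coneMap : ∀ {m} → (Fin m → V) → Fin (suc m) → V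
    coneMap f zero    = t
    coneMap f (suc u) = f u

    coneMap-injective : ∀ {m} {f : Fin m → V} → (∀ u → f u ∈ X) → Injective _≡_ _≡_ f →
      Injective _≡_ _≡_ (coneMap f)
    coneMap-injective f∈ inj {zero} {zero} _ = refl
    coneMap-injective f∈ inj {zero} {suc v} e = contradiction (subst (_∈ X) (sym e) (f∈ v)) t∉X
    coneMap-injective f∈ inj {suc u} {zero} e = contradiction (subst (_∈ X) e (f∈ u)) t∉X
    coneMap-injective f∈ inj {suc u} {suc v} e = cong suc (inj e)

    coneMap-∈ : ∀ {m} {f : Fin m → V} → (∀ u → f u ∈ X) → ∀ u → coneMap f u ∈ S
    coneMap-∈ f∈ zero    = t∈S
    coneMap-∈ f∈ (suc u) = X⊆S (f∈ u)

    cycle→wheel : ∀ {m} → Copy i X (Cycle m) → Copy i S (Wheel m)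
    cycle→wheel {m} ((f , inj , edge) , f∈) =
      (coneMap f , coneMap-injective f∈ inj , edge′) , coneMap-∈ f∈
      where
      edge′ : ∀ u v → Wheel m u v → c (coneMap f u) (coneMap f v) ≡ i
      edge′ zero    (suc v) _ = t-X (f∈ v)
      edge′ (suc u) zero    _ = trans (c-sym _ _) (t-X (f∈ u))
      edge′ (suc u) (suc v) e = edge u v e

    -- The vertex `t` closes the path, being joined to both of its ends. The path is nonempty, since
    -- `Cycle 1` would ask for a loop at `t`.
    path→cycle : ∀ {m} → Copy i X (Path (suc m)) → Copy i S (Cycle (2 + m))
    path→cycle {m} ((f , inj , edge) , f∈) =
      (coneMap f , coneMap-injective f∈ inj , edge′) , coneMap-∈ f∈
      where
      edge′ : ∀ u v → Cycle (2 + m) u v → c (coneMap f u) (coneMap f v) ≡ i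
      edge′ zero    (suc v) _ = t-X (f∈ v)
      edge′ (suc u) zero    _ = trans (c-sym _ _) (t-X (f∈ u))
      edge′ (suc u) (suc v) (inj₁ (inj₁ e)) = edge u v (inj₁ (suc-injective e))
      edge′ (suc u) (suc v) (inj₁ (inj₂ e)) = edge u v (inj₂ (suc-injective e))
      edge′ zero    zero    (inj₁ (inj₁ ()))
      edge′ zero    zero    (inj₁ (inj₂ ()))
      edge′ zero    zero    (inj₂ (inj₁ (_ , ())))
      edge′ zero    zero    (inj₂ (inj₂ (_ , ())))
      edge′ (suc _) (suc _) (inj₂ (inj₁ (() , _)))
      edge′ (suc _) (suc _) (inj₂ (inj₂ (() , _)))

  -- Prepends alternately vertices of T and unused vertices of X.
  zigzag : ∀ {S X T : List V} {i m} e → Unique X → Unique T →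
    (∀ {x} → x ∈ X → x ∈ S) → (∀ {t} → t ∈ T → t ∈ S × t ∉ X) →
    (∀ {t x} → t ∈ T → x ∈ X → c t x ≡ i) → e ≤ length T → (P : PathIn S i m) →
    (∀ {t} → t ∈ T → t ∉ vertices P × Linked (λ u v → c u v ≡ i) (t ∷ vertices P)) →
    m + e ≤ suc (length X) → PathIn S i (m + e)
  zigzag zero _ _ _ _ _ _ P _ _ = subst (PathIn _ _) (sym (+-identityʳ _)) P
  zigzag {T = t ∷ T} {m = m} 1 _ _ _ T⊆ _ _ (mkPath q lk u w s) attach _ = mkPath (t ∷ q)
    (proj₂ (attach (here refl))) (¬Any⇒All¬ q (proj₁ (attach (here refl))) ∷ u)
    (proj₁ (T⊆ (here refl)) ∷ w) (trans (cong suc s) (+-comm 1 m))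
  zigzag {S} {X} {t ∷ T} {i} {m} (suc (suc e)) uX uT@(_ ∷ uT′) X⊆ T⊆ T-X (s≤s e≤)
    (mkPath q lk u w size) attach room =
    -- The path has `m` vertices and `room` leaves `m` below `length X`, so some vertex of `X` is
    -- still off the path.
    let (s , s∈ , s∉) = fresh {ys = q} uX (subst (_< length X) (sym size)
                          (≤-trans (m≤m+n (suc m) e) (≤-pred (subst (_≤ suc (length X)) m+e room))))
        (t∈S , t∉X) = T⊆ (here refl)
        (t∉q , lk-t) = attach (here refl)
        s∉tq = λ { (here refl) → t∉X s∈ ; (there s∈q) → s∉ s∈q }
    in subst (PathIn S i) (sym m+e)
         (zigzag e uX uT′ X⊆ (T⊆ ∘ there) (T-X ∘ there) (<⇒≤ e≤)
           (mkPath (s ∷ t ∷ q) (trans (c-sym s t) (T-X (here refl) s∈) ∷ lk-t)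
             (¬Any⇒All¬ _ s∉tq ∷ ¬Any⇒All¬ _ t∉q ∷ u) (X⊆ s∈ ∷ t∈S ∷ w) (cong (2 +_) size))
           -- The new head `s` lies in `X`, so every remaining vertex of `T` can be attached to it.
           (λ t′∈ → (λ { (here refl) → proj₂ (T⊆ (there t′∈)) s∈
                       ; (there (here refl)) → Unique[x∷xs]⇒x∉xs uT t′∈
                       ; (there (there t′∈q)) → proj₁ (attach (there t′∈)) t′∈q }) ,
                    T-X (there t′∈) s∈ ∷ trans (c-sym s t) (T-X (here refl) s∈) ∷ lk-t)
           (subst (_≤ suc (length X)) m+e room))
    where
    m+e : m + suc (suc e) ≡ suc (suc (m + e))
    m+e = trans (+-suc m (suc e)) (cong suc (+-suc m e))

  -- As long as the path has fewer than `d` vertices, its head has a neighbour off the path. The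
  -- degree may count the vertex itself, as `c x x` is arbitrary; hence `d` vertices are claimed
  -- rather than `d + 1`.
  greedyPath : ∀ {S i d x} → Unique S → x ∈ S →
    (∀ {x} → x ∈ S → d ≤ length (filter (λ y → c x y Fin.≟ i) S)) →
    ∀ m → m ≤ d → PathIn S i m
  greedyPath uS x∈ deg zero _ = mkPath [] [] [] [] refl
  greedyPath uS x∈ deg (suc zero) _ = mkPath (_ ∷ []) [-] ([] ∷ []) (x∈ ∷ []) refl
  greedyPath {S} {i} {d} uS x∈ deg (suc (suc m)) m<d with greedyPath uS x∈ deg (suc m) (<⇒≤ m<d)
  ... | mkPath (h ∷ q) lk u w@(h∈ ∷ _) size =
    let (y , y∈ , y∉) = fresh {ys = h ∷ q} (Uniq.filter⁺ (λ y → c h y Fin.≟ i) uS)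
                          (≤-trans (subst (λ l → suc l ≤ d) (sym size) m<d) (deg h∈))
        (y∈S , hy) = ∈-filter⁻ (λ y → c h y Fin.≟ i) {xs = S} y∈
    in mkPath (y ∷ h ∷ q) (trans (c-sym y h) hy ∷ lk) (¬Any⇒All¬ _ y∉ ∷ u) (y∈S ∷ w) (cong suc size)

  TwoColoured : List V → Fin k → Fin k → Set
  TwoColoured L a b = ∀ {u w} → u ∈ L → w ∈ L → u ≢ w → c u w ≡ a ⊎ c u w ≡ b

  -- Gerencsér–Gyárfás.
  twoPaths : ∀ {L a b} → Unique L → TwoColoured L a b →
    ∃ λ p → ∃ λ q → Linked (λ u v → c u v ≡ a) p × Linked (λ u v → c u v ≡ b) q × p ++ q ↭ L
  twoPaths {[]} _ _ = [] , [] , [] , [] , ↭-refl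
  twoPaths {x ∷ L} {a} {b} uxL@(_ ∷ uL) two
    with twoPaths uL (λ u∈ w∈ → two (there u∈) (there w∈))
  ... | [] , q , _ , lq , pq = x ∷ [] , q , [-] , lq , prep x pq
  ... | u ∷ p , [] , lp , _ , pq =
        u ∷ p , x ∷ [] , lp , [-] , ↭-trans (shift x (u ∷ p) []) (prep x pq)
  ... | u ∷ p , w ∷ q , lp , lq , pq = extend (xV u∈) (xV w∈) (two (there u∈) (there w∈) u≢w)
    where
    u∈ : u ∈ L
    u∈ = ∈-resp-↭ pq (here refl)
    w∈ : w ∈ L
    w∈ = ∈-resp-↭ pq (∈-++⁺ʳ (u ∷ p) (here refl))
    u≢w : u ≢ w
    u≢w refl = Unique[x∷xs]⇒x∉xs
      (Permₛ.Unique-resp-↭ (setoid V) (↭⇒↭ₛ (↭-sym pq)) uL) (∈-++⁺ʳ p (here refl))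
    xV : ∀ {y} → y ∈ L → c x y ≡ a ⊎ c x y ≡ b
    xV y∈ = two (here refl) (there y∈) λ { refl → Unique[x∷xs]⇒x∉xs uxL y∈ }

    extend : c x u ≡ a ⊎ c x u ≡ b → c x w ≡ a ⊎ c x w ≡ b → c u w ≡ a ⊎ c u w ≡ b →
      ∃ λ p → ∃ λ q → Linked (λ u v → c u v ≡ a) p × Linked (λ u v → c u v ≡ b) q × p ++ q ↭ x ∷ L
    extend (inj₁ xu) _ _ = x ∷ u ∷ p , w ∷ q , xu ∷ lp , lq , prep x pq
    extend _ (inj₂ xw) _ = u ∷ p , x ∷ w ∷ q , lp , xw ∷ lq ,
      ↭-trans (shift x (u ∷ p) (w ∷ q)) (prep x pq)
    -- If `x` fits onto neither head, the colour of the edge between the heads decides which head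
    -- moves over to the other path, with `x` placed in front of it.
    extend (inj₂ xu) (inj₁ xw) (inj₁ uw) = x ∷ w ∷ u ∷ p , q , xw ∷ trans (c-sym w u) uw ∷ lp ,
      Linked.tail lq , prep x (↭-trans (↭-sym (shift w (u ∷ p) q)) pq)
    extend (inj₂ xu) (inj₁ xw) (inj₂ uw) = p , x ∷ u ∷ w ∷ q , Linked.tail lp , xu ∷ uw ∷ lq ,
      ↭-trans (shift x p (u ∷ w ∷ q)) (prep x (↭-trans (shift u p (w ∷ q)) pq))

  -- Two paths that cover at least `2l - 1` vertices cannot both have fewer than `l`.
  ramseyPath : ∀ {S L a b l} → Unique L → (∀ {x} → x ∈ L → x ∈ S) → TwoColoured L a b →
    l + l ≤ suc (length L) → PathIn S a l ⊎ PathIn S b l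
  ramseyPath {S} {L} {a} {b} {l} uL L⊆S two long with twoPaths uL two
  ... | p , q , lp , lq , pq
    with Unique-++⁻ p (Permₛ.Unique-resp-↭ (setoid V) (↭⇒↭ₛ (↭-sym pq)) uL)
  ... | up , uq with l ≤? length p
  ... | yes l≤p = inj₁ (shorten l≤p
          (mkPath p lp up (All.tabulate (L⊆S ∘ ∈-resp-↭ pq ∘ ∈-++⁺ˡ)) refl))
  ... | no l≰p = inj₂ (shorten l≤q
          (mkPath q lq uq (All.tabulate (L⊆S ∘ ∈-resp-↭ pq ∘ ∈-++⁺ʳ p)) refl))
    where
    l≤q : l ≤ length q
    l≤q = +-cancelˡ-≤ l l (length q) (≤-trans long (subst (λ z → suc z ≤ l + length q)
      (trans (sym (length-++ p)) (↭-length pq)) (+-monoˡ-≤ (length q) (≰⇒> l≰p))))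

  -- With one colour, any enumeration of `L` is a path, so no factor two is lost as in `ramseyPath`.
  monoPath : ∀ {S L a} → Unique L → (∀ {x} → x ∈ L → x ∈ S) → TwoColoured L a a →
    PathIn S a (length L)
  monoPath {L = L} {a} uL L⊆S two = mkPath L (chain uL λ u∈ w∈ d → [ id , id ]′ (two u∈ w∈ d)) uL (All.tabulate L⊆S) refl
    where
    chain : ∀ {L} → Unique L → (∀ {u w} → u ∈ L → w ∈ L → u ≢ w → c u w ≡ a) →
      Linked (λ u v → c u v ≡ a) L
    chain {[]} _ _ = []
    chain {x ∷ []} _ _ = [-]
    chain {x ∷ y ∷ L} ((x≢y ∷ _) ∷ u) all =
      all (here refl) (there (here refl)) x≢y ∷ chain u λ u∈ w∈ → all (there u∈) (there w∈)

  -- Greedy choice: a chosen `x` discards itself and the vertices joined to it in a third colour.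
  -- These all lie in the small set around `x`, so each choice costs at most `D` vertices.
  transversal : ∀ {S a b D} →
    (∀ {x} → x ∈ S → ∃ λ X → length X ≤ D × x ∈ X ×
       (∀ {y} → y ∈ S → ¬ (c x y ≡ a ⊎ c x y ≡ b) → y ∈ X)) →
    ∀ R → Unique R → (∀ {x} → x ∈ R → x ∈ S) → Acc _<_ (length R) →
    ∃ λ L → Unique L × (∀ {x} → x ∈ L → x ∈ R) × TwoColoured L a b × length R ≤ length L * D
  transversal small [] uR R⊆S _ = [] , [] , (λ ()) , (λ ()) , z≤n
  transversal {S} {a} {b} {D} small (x ∷ R) uxR@(_ ∷ uR) R⊆S (acc rs)
    with transversal {a = a} {b} small (filter ab? R) (Uniq.filter⁺ ab? uR)
           (λ y∈ → R⊆S (there (proj₁ (∈-filter⁻ ab? y∈)))) (rs (s≤s (length-filter ab? R)))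
    where
    ab? : Decidable (λ y → c x y ≡ a ⊎ c x y ≡ b)
    ab? y = (c x y Fin.≟ a) ⊎-dec (c x y Fin.≟ b)
  ... | L , uL , L⊆R , two , long = x ∷ L , ¬Any⇒All¬ L x∉L ∷ uL ,
        (λ { (here refl) → here refl ; (there y∈) → there (L⊆R′ y∈) }) , two′ ,
        subst (_≤ D + length L * D) (cong suc (length-filter-split ab? R))
          (subst (_≤ D + length L * D) (trans (+-comm (suc (length removed)) _) (+-suc _ _))
            (+-mono-≤ removed≤D long))
    where
    ab? : Decidable (λ y → c x y ≡ a ⊎ c x y ≡ b)
    ab? y = (c x y Fin.≟ a) ⊎-dec (c x y Fin.≟ b)
    L⊆R′ : ∀ {y} → y ∈ L → y ∈ R
    L⊆R′ y∈ = proj₁ (∈-filter⁻ ab? (L⊆R y∈))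
    x∉L : x ∉ L
    x∉L x∈ = Unique[x∷xs]⇒x∉xs uxR (L⊆R′ x∈)
    two′ : TwoColoured (x ∷ L) a b
    two′ (here refl) (here refl) d = contradiction refl d
    two′ (here refl) (there w∈) _ = proj₂ (∈-filter⁻ ab? {xs = R} (L⊆R w∈))
    two′ {u} (there u∈) (here refl) _ rewrite c-sym u x = proj₂ (∈-filter⁻ ab? {xs = R} (L⊆R u∈))
    two′ (there u∈) (there w∈) d = two u∈ w∈ d
    removed = filter (¬? ∘ ab?) R
    removed≤D : suc (length removed) ≤ D
    removed≤D =
      let (X , X≤D , x∈X , X⊇) = small (R⊆S (here refl))
          rem⁻ = λ {y} (y∈ : y ∈ removed) → ∈-filter⁻ (¬? ∘ ab?) {xs = R} y∈
      in ≤-trans (Unique-⊆⇒length≤ {xs = x ∷ removed}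
           (¬Any⇒All¬ _ (λ x∈ → Unique[x∷xs]⇒x∉xs uxR (proj₁ (rem⁻ x∈))) ∷ Uniq.filter⁺ (¬? ∘ ab?) uR)
           λ { (here refl) → x∈X ; (there y∈) → X⊇ (R⊆S (there (proj₁ (rem⁻ y∈)))) (proj₂ (rem⁻ y∈)) })
         X≤D

-- Weights, budgets and the potential.

n<2^n : ∀ n → n < 2 ^ n
n<2^n zero = s≤s z≤n
n<2^n (suc n) = begin-strict
  suc n             ≤⟨ n<2^n n ⟩
  2 ^ n             <⟨ m<m+n (2 ^ n) (≤-trans (s≤s z≤n) (n<2^n n)) ⟩
  2 ^ n + 2 ^ n     ≡⟨ cong (2 ^ n +_) (sym (+-identityʳ (2 ^ n))) ⟩
  2 ^ suc n         ∎
  where open ≤-Reasoning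

2n≤2^n : ∀ n → 2 * suc n ≤ 2 ^ suc n
2n≤2^n n = *-monoʳ-≤ 2 (n<2^n n)

-- Throughout, n = 6 + p, so W_n is Wheel (5 + p), C_{n-1} is Cycle (5 + p) and P_{n-2} is Path (4 + p).
module Potential (p : ℕ) where

  data Status : Set where
    wheel cycle : Status
    path        : ℕ → Status

  -- The weight of a path is independent of its length, so shortening a path affects the budget
  -- only, while demoting a wheel or cycle is paid for by the weight.
  weight budget : Status → ℕ
  weight wheel    = 30
  weight cycle    = 10
  weight (path _) = 2
  budget wheel    = 5 + p
  budget cycle    = 5 + p
  budget (path m) = m

  totalWeight totalBudget : ∀ {k} → Vec Status k → ℕ
  totalWeight []      = 1
  totalWeight (s ∷ σ) = weight s * totalWeight σ
  totalBudget []      = 0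
  totalBudget (s ∷ σ) = budget s + totalBudget σ

  Φ : ∀ {k} → Vec Status k → ℕ
  Φ σ = (2 + p) ^ 2 * totalWeight σ + totalBudget σ

  -- Cross-multiplied in order to avoid division; the version for budgets likewise avoids
  -- subtraction.
  totalWeight-≔ : ∀ {k} (σ : Vec Status k) i s →
    totalWeight (σ [ i ]≔ s) * weight (Vec.lookup σ i) ≡ totalWeight σ * weight s
  totalWeight-≔ (s₀ ∷ σ) zero s = swap-ends (weight s) (totalWeight σ) (weight s₀)
    where
    swap-ends : ∀ a b c → a * b * c ≡ c * b * a
    swap-ends = solve-∀
  totalWeight-≔ (s₀ ∷ σ) (suc i) s = begin
    weight s₀ * totalWeight (σ [ i ]≔ s) * weight (Vec.lookup σ i)   ≡⟨ *-assoc (weight s₀) _ _ ⟩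
    weight s₀ * (totalWeight (σ [ i ]≔ s) * weight (Vec.lookup σ i)) ≡⟨ cong (weight s₀ *_) (totalWeight-≔ σ i s) ⟩
    weight s₀ * (totalWeight σ * weight s)                           ≡⟨ *-assoc (weight s₀) _ _ ⟨
    weight s₀ * totalWeight σ * weight s                             ∎
    where open ≡-Reasoning

  totalBudget-≔ : ∀ {k} (σ : Vec Status k) i s →
    totalBudget (σ [ i ]≔ s) + budget (Vec.lookup σ i) ≡ totalBudget σ + budget s
  totalBudget-≔ (s₀ ∷ σ) zero s = swap-ends (budget s) (totalBudget σ) (budget s₀)
    where
    swap-ends : ∀ a b c → a + b + c ≡ c + b + a
    swap-ends = solve-∀
  totalBudget-≔ (s₀ ∷ σ) (suc i) s = begin
    budget s₀ + totalBudget (σ [ i ]≔ s) + budget (Vec.lookup σ i)   ≡⟨ +-assoc (budget s₀) _ _ ⟩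
    budget s₀ + (totalBudget (σ [ i ]≔ s) + budget (Vec.lookup σ i)) ≡⟨ cong (budget s₀ +_) (totalBudget-≔ σ i s) ⟩
    budget s₀ + (totalBudget σ + budget s)                           ≡⟨ +-assoc (budget s₀) _ _ ⟨
    budget s₀ + totalBudget σ + budget s                             ∎
    where open ≡-Reasoning

  2≤weight : ∀ s → 2 ≤ weight s
  2≤weight wheel    = s≤s (s≤s z≤n)
  2≤weight cycle    = s≤s (s≤s z≤n)
  2≤weight (path _) = s≤s (s≤s z≤n)

  2^k≤totalWeight : ∀ {k} (σ : Vec Status k) → 2 ^ k ≤ totalWeight σ
  2^k≤totalWeight []      = ≤-refl
  2^k≤totalWeight (s ∷ σ) = *-mono-≤ (2≤weight s) (2^k≤totalWeight σ)

  totalBudget≤ : ∀ {k} (σ : Vec Status k) → (∀ i → budget (Vec.lookup σ i) ≤ 5 + p) →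
    totalBudget σ ≤ k * (5 + p)
  totalBudget≤ []      _  = z≤n
  totalBudget≤ (s ∷ σ) b≤ = +-mono-≤ (b≤ zero) (totalBudget≤ σ (λ i → b≤ (suc i)))

  -- The statuses that a single joined vertex already weakens.
  data Big : Status → Set where
    wheel : Big wheel
    cycle : Big cycle

  demote : Status → Status
  demote wheel    = cycle
  demote _        = path (4 + p)

  big? : ∀ s → Big s ⊎ ∃ λ m → s ≡ path m
  big? wheel    = inj₁ wheel
  big? cycle    = inj₁ cycle
  big? (path m) = inj₂ (m , refl)

  cycle-fifth : ∀ {k} (σ : Vec Status k) i {m} → Vec.lookup σ i ≡ cycle →
    5 * totalWeight (σ [ i ]≔ path m) ≡ totalWeight σ
  cycle-fifth σ i {m} e = *-cancelʳ-≡ _ _ 2 (trans (reorder (totalWeight (σ [ i ]≔ path m)))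
    (subst (λ s → totalWeight (σ [ i ]≔ path m) * weight s ≡ totalWeight σ * 2) e (totalWeight-≔ σ i (path m))))
    where
    reorder : ∀ x → 5 * x * 2 ≡ x * 10
    reorder = solve-∀

  wheel-third : ∀ {k} (σ : Vec Status k) i → Vec.lookup σ i ≡ wheel →
    3 * totalWeight (σ [ i ]≔ cycle) ≡ totalWeight σ
  wheel-third σ i e = *-cancelʳ-≡ _ _ 10 (trans (reorder (totalWeight (σ [ i ]≔ cycle)))
    (subst (λ s → totalWeight (σ [ i ]≔ cycle) * weight s ≡ totalWeight σ * 10) e (totalWeight-≔ σ i cycle)))
    where
    reorder : ∀ x → 3 * x * 10 ≡ x * 30
    reorder = solve-∀

  demote-third : ∀ {k} (σ : Vec Status k) i → Big (Vec.lookup σ i) →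
    3 * totalWeight (σ [ i ]≔ demote (Vec.lookup σ i)) ≤ totalWeight σ
  demote-third σ i big with Vec.lookup σ i in e
  demote-third σ i wheel | wheel = ≤-reflexive (wheel-third σ i e)
  demote-third σ i cycle | cycle =
    ≤-trans (*-monoˡ-≤ (totalWeight (σ [ i ]≔ path (4 + p))) {3} {5} (s≤s (s≤s (s≤s z≤n))))
            (≤-reflexive (cycle-fifth σ i e))

  -- Two weakened parts fit into the original weight with room for three error terms `2 ^ k`, each
  -- of which will absorb budgets or a small remaining part.
  demote-gap : ∀ {k} (σ : Vec Status k) i → Big (Vec.lookup σ i) →
    2 * totalWeight (σ [ i ]≔ demote (Vec.lookup σ i)) + 3 * 2 ^ k ≤ totalWeight σ
  demote-gap {k} σ i big with Vec.lookup σ i in e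
  demote-gap {k} σ i wheel | wheel = begin
    2 * w + 3 * 2 ^ k ≤⟨ +-monoʳ-≤ (2 * w) gap ⟩
    2 * w + w         ≡⟨ +-comm (2 * w) w ⟩
    3 * w             ≡⟨ wheel-third σ i e ⟩
    totalWeight σ     ∎
    where
    open ≤-Reasoning
    σ′ = σ [ i ]≔ cycle
    w = totalWeight σ′
    gap : 3 * 2 ^ k ≤ w
    gap = begin
      -- The cycle that replaced the wheel makes `w` five times a weight that is still at least
      -- `2 ^ k`. The length 0 is arbitrary, as path weights ignore it.
      3 * 2 ^ k                                    ≤⟨ *-mono-≤ {3} {5} (s≤s (s≤s (s≤s z≤n))) (2^k≤totalWeight (σ′ [ i ]≔ path 0)) ⟩
      5 * totalWeight (σ′ [ i ]≔ path 0)           ≡⟨ cycle-fifth σ′ i (lookup∘update i σ cycle) ⟩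
      w                                            ∎
  demote-gap {k} σ i cycle | cycle = begin
    2 * w + 3 * 2 ^ k ≤⟨ +-monoʳ-≤ (2 * w) (*-monoʳ-≤ 3 (2^k≤totalWeight (σ [ i ]≔ path (4 + p)))) ⟩
    2 * w + 3 * w     ≡⟨ *-distribʳ-+ w 2 3 ⟨
    5 * w             ≡⟨ cycle-fifth σ i e ⟩
    totalWeight σ     ∎
    where
    open ≤-Reasoning
    w = totalWeight (σ [ i ]≔ path (4 + p))

  -- The purpose of the budgets: dropping `j` vertices from the set and from the path lowers both
  -- sides of the size condition equally.
  Φ-shorten : ∀ {k} (σ : Vec Status k) i {m j} → Vec.lookup σ i ≡ path m → j ≤ m →
    Φ (σ [ i ]≔ path (m ∸ j)) + j ≡ Φ σ
  Φ-shorten σ i {m} {j} e j≤m = begin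
    D² * totalWeight σ′ + totalBudget σ′ + j   ≡⟨ +-assoc (D² * totalWeight σ′) _ j ⟩
    D² * totalWeight σ′ + (totalBudget σ′ + j) ≡⟨ cong₂ (λ x y → D² * x + y) same-weight less-budget ⟩
    Φ σ                                        ∎
    where
    open ≡-Reasoning
    D² = (2 + p) ^ 2
    σ′ = σ [ i ]≔ path (m ∸ j)
    same-weight : totalWeight σ′ ≡ totalWeight σ
    same-weight = *-cancelʳ-≡ _ _ 2
      (subst (λ s → totalWeight σ′ * weight s ≡ totalWeight σ * 2) e (totalWeight-≔ σ i (path (m ∸ j))))
    less-budget : totalBudget σ′ + j ≡ totalBudget σ
    less-budget = +-cancelʳ-≡ (m ∸ j) _ _ (begin
      totalBudget σ′ + j + (m ∸ j)   ≡⟨ +-assoc (totalBudget σ′) j (m ∸ j) ⟩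
      totalBudget σ′ + (j + (m ∸ j)) ≡⟨ cong (totalBudget σ′ +_) (m+[n∸m]≡n j≤m) ⟩
      totalBudget σ′ + m             ≡⟨ subst (λ s → totalBudget σ′ + budget s ≡ totalBudget σ + (m ∸ j)) e
                                          (totalBudget-≔ σ i (path (m ∸ j))) ⟩
      totalBudget σ + (m ∸ j)        ∎)

  6+p≤2D² : 6 + p ≤ 2 * (2 + p) ^ 2
  6+p≤2D² = ≤-trans (m≤m+n (6 + p) (2 + (7 * p + 2 * (p * p)))) (≤-reflexive (expand p))
    where
    expand : ∀ p → 6 + p + (2 + (7 * p + 2 * (p * p))) ≡ 2 * ((2 + p) * ((2 + p) * 1))
    expand = solve-∀

  6+p≤D²2^k : ∀ k → 6 + p ≤ (2 + p) ^ 2 * 2 ^ suc k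
  6+p≤D²2^k k = begin
    6 + p                   ≤⟨ 6+p≤2D² ⟩
    2 * (2 + p) ^ 2         ≡⟨ *-comm 2 ((2 + p) ^ 2) ⟩
    (2 + p) ^ 2 * 2         ≤⟨ *-monoʳ-≤ ((2 + p) ^ 2) (≤-trans (m≤m*n 2 (suc k)) (2n≤2^n k)) ⟩
    (2 + p) ^ 2 * 2 ^ suc k ∎
    where open ≤-Reasoning

  -- All budgets together amount to at most one error term, because `n - 1 ≤ 2(n-4)²` and
  -- `2k ≤ 2 ^ k` for positive `k`.
  budgets≤D²2^k : ∀ k → k * (5 + p) ≤ (2 + p) ^ 2 * 2 ^ k
  budgets≤D²2^k zero = z≤n
  budgets≤D²2^k (suc k) = begin
    suc k * (5 + p)               ≤⟨ *-monoʳ-≤ (suc k) (≤-trans (n≤1+n (5 + p)) 6+p≤2D²) ⟩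
    suc k * (2 * (2 + p) ^ 2)     ≡⟨ *-assoc (suc k) 2 ((2 + p) ^ 2) ⟨
    suc k * 2 * (2 + p) ^ 2       ≡⟨ cong (_* (2 + p) ^ 2) (*-comm (suc k) 2) ⟩
    2 * suc k * (2 + p) ^ 2       ≤⟨ *-monoˡ-≤ ((2 + p) ^ 2) (2n≤2^n k) ⟩
    2 ^ suc k * (2 + p) ^ 2       ≡⟨ *-comm (2 ^ suc k) ((2 + p) ^ 2) ⟩
    (2 + p) ^ 2 * 2 ^ suc k       ∎
    where open ≤-Reasoning

-- `G` need not be decidable, so it is extracted by running through the finite list.
collect : ∀ {A : Set} {G : Set} {Q : A → Set} (xs : List A) → (∀ {x} → x ∈ xs → G ⊎ Q x) →
  G ⊎ (∀ {x} → x ∈ xs → Q x)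
collect [] f = inj₂ λ ()
collect (x ∷ xs) f with f (here refl) | collect xs (f ∘ there)
... | inj₁ g | _      = inj₁ g
... | inj₂ _ | inj₁ g = inj₁ g
... | inj₂ q | inj₂ h = inj₂ λ { (here refl) → q ; (there x∈) → h x∈ }

-- The induction on the size of the vertex set.

module Main {N k : ℕ} (c : Fin N → Fin N → Fin k) (c-sym : ∀ u v → c u v ≡ c v u)
            (¬rainbow : ¬ RainbowTriangle c) (p : ℕ) (Goal : Set) where

  open Gallai c c-sym ¬rainbow using (Cut; ModuleAt; moduleAt; gallaiCut; swap)
  open Copies c c-sym
  open Potential p

  -- What colour i still has to avoid in S, stated positively so that Goal need not be decidable.
  Wins : Status → Fin k → List V → Set
  Wins wheel    i S = Copy i S (Wheel (5 + p)) → Goal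
  Wins cycle    i S = Copy i S (Cycle (5 + p)) → Goal
  Wins (path m) i S = m ≤ 4 + p × (PathIn S i m → Goal)

  AllWin : Vec Status k → List V → Set
  AllWin σ S = ∀ i → Wins (Vec.lookup σ i) i S

  Joined : List V → List V → Fin k → List V → Set
  Joined S X i T = ∀ {t} → t ∈ T → t ∈ S × t ∉ X × (∀ {u} → u ∈ X → c t u ≡ i)

  Wins-⊆ : ∀ {S X i} s → (∀ {x} → x ∈ X → x ∈ S) → Wins s i S → Wins s i X
  Wins-⊆ wheel    X⊆S win (H , H∈) = win (H , X⊆S ∘ H∈)
  Wins-⊆ cycle    X⊆S win (H , H∈) = win (H , X⊆S ∘ H∈)
  Wins-⊆ (path m) X⊆S (m≤ , win)   = m≤ , win ∘ enlarge X⊆S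

  AllWin-⊆ : ∀ {S X} σ → (∀ {x} → x ∈ X → x ∈ S) → AllWin σ S → AllWin σ X
  AllWin-⊆ σ X⊆S win i = Wins-⊆ (Vec.lookup σ i) X⊆S (win i)

  AllWin-≔ : ∀ {X i s} σ → AllWin σ X → Wins s i X → AllWin (σ [ i ]≔ s) X
  AllWin-≔ {X} {i} {s} σ win w j with j Fin.≟ i
  ... | yes refl = subst (λ s → Wins s i X) (sym (lookup∘update i σ s)) w
  ... | no j≢i = subst (λ s → Wins s j X) (sym (lookup∘update′ j≢i σ s)) (win j)

  -- Coning with `t` turns the demoted graph in `X` back into the original graph in `S`.
  Wins-demote : ∀ {S X t i s} → Big s → (∀ {x} → x ∈ X → x ∈ S) → t ∈ S → t ∉ X →
    (∀ {u} → u ∈ X → c t u ≡ i) → Wins s i S → Wins (demote s) i X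
  Wins-demote wheel X⊆S t∈S t∉X t-X win = win ∘ Cone.cycle→wheel X⊆S t∈S t∉X t-X
  Wins-demote cycle X⊆S t∈S t∉X t-X win =
    ≤-refl , win ∘ Cone.path→cycle X⊆S t∈S t∉X t-X ∘ pathCopy

  Wins-shorten : ∀ {S X T i m} → Unique X → Unique T → (∀ {x} → x ∈ X → x ∈ S) → Joined S X i T →
    3 + p ≤ length X → Wins (path m) i S → Wins (path (m ∸ length T)) i X
  Wins-shorten {S} {X} {T} {i} {m} uX uT X⊆S join room (m≤ , win) = ≤-trans (m∸n≤m m j) m≤ , λ Q →
    -- If `T` has more than `m` vertices, the given path is empty and only `m` vertices are to be
    -- added; hence the minimum.
    win (subst (PathIn S i) total (zigzag (j ⊓ m) uX uT X⊆S
      (λ t∈ → let (t∈S , t∉X , _) = join t∈ in t∈S , t∉X) (λ t∈ x∈ → proj₂ (proj₂ (join t∈)) x∈)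
      (m⊓n≤m j m) (enlarge X⊆S Q)
      (λ t∈ → (λ t∈q → proj₁ (proj₂ (join t∈)) (All.lookup (PathIn.within Q) t∈q)) , attach t∈ Q)
      (subst (_≤ suc (length X)) (sym total) (≤-trans m≤ (s≤s room)))))
    where
    j = length T
    total : m ∸ j + j ⊓ m ≡ m
    total = trans (+-comm (m ∸ j) (j ⊓ m)) (m⊓n+n∸m≡n j m)
    attach : ∀ {t l} → t ∈ T → (Q : PathIn X i l) → Linked (λ u v → c u v ≡ i) (t ∷ PathIn.vertices Q)
    attach t∈ (mkPath [] _ _ _ _) = [-]
    attach t∈ (mkPath (_ ∷ _) lk _ (h∈ ∷ _) _) = proj₂ (proj₂ (join t∈)) h∈ ∷ lk

  winPath : ∀ {S i m} → Wins (path m) i S → PathIn S i (4 + p) → Goal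
  winPath (m≤ , win) P = win (shorten m≤ P)

  -- The path left to avoid has no vertices, so it exists.
  exhausted : ∀ {S i m j} → ¬ j ≤ m → Wins (path (m ∸ j)) i S → Goal
  exhausted {S} {i} j≰m (_ , win) =
    win (subst (PathIn S i) (sym (m≤n⇒m∸n≡0 (<⇒≤ (≰⇒> j≰m)))) (mkPath [] [] [] [] refl))

  budget≤ : ∀ {S i} s → Wins s i S → budget s ≤ 5 + p
  budget≤ wheel    _        = ≤-refl
  budget≤ cycle    _        = ≤-refl
  budget≤ (path m) (m≤ , _) = m≤n⇒m≤1+n m≤

  -- `X` is the module of `x`. Outer vertices seen in colour `a` all go to `A`, so `B` can be
  -- inhabited only if the two colours differ.
  record Parts (S : List V) (a b : Fin k) (x : V) : Set where
    field
      X A B    : List V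
      uX       : Unique X
      uA       : Unique A
      uB       : Unique B
      count    : length X + (length A + length B) ≡ length S
      proper   : 0 < length A + length B
      x∈X      : x ∈ X
      X⊆S      : ∀ {y} → y ∈ X → y ∈ S
      joinA    : Joined S X a A
      joinB    : Joined S X b B
      distinct : ∀ {t} → t ∈ B → a ≢ b
      rest     : ∀ {y} → y ∈ S → ¬ (c x y ≡ a ⊎ c x y ≡ b) → y ∈ X

  parts : ∀ {S a b x} → Unique S → Cut S a b → x ∈ S → Parts S a b x
  parts {S} {a} {b} {x} uS C x∈ = record
    { X = X ; A = A ; B = B
    ; uX = Uniq.filter⁺ side? uS
    ; uA = Uniq.filter⁺ a? uY
    ; uB = Uniq.filter⁺ (¬? ∘ a?) uY
    ; count = trans (cong (length X +_) (length-filter-split a? Y)) (length-filter-split side? S)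
    ; proper = subst (0 <_) (sym (length-filter-split a? Y)) nonempty
    ; x∈X = ∈-filter⁺ side? x∈ centre
    ; X⊆S = λ y∈ → proj₁ (∈-filter⁻ side? y∈)
    ; joinA = λ t∈ → let (t∈Y , xt) = ∈-filter⁻ a? {xs = Y} t∈ in join t∈Y xt
    ; joinB = λ t∈ → let (t∈Y , xt) = ∈-filter⁻ (¬? ∘ a?) {xs = Y} t∈ in join t∈Y (other t∈Y xt)
    ; distinct = λ { t∈ refl → let (t∈Y , xt) = ∈-filter⁻ (¬? ∘ a?) {xs = Y} t∈ in xt (other t∈Y xt) }
    ; rest = λ {y} y∈ ¬ab → ∈-filter⁺ side? y∈ (decidable-stable (side? y) λ ¬s →
               ¬ab (cross x∈ y∈ centre ¬s))
    }
    where
    open ModuleAt (moduleAt C x∈)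
    open Cut cut
    X = filter side? S
    Y = filter (¬? ∘ side?) S
    a? : Decidable (λ y → c x y ≡ a)
    a? y = c x y Fin.≟ a
    A = filter a? Y
    B = filter (¬? ∘ a?) Y
    uY = Uniq.filter⁺ (¬? ∘ side?) uS
    nonempty : 0 < length Y
    nonempty with Y | ∈-filter⁺ (¬? ∘ side?) (proj₁ (proj₂ outer)) (proj₂ (proj₂ outer))
    ... | _ ∷ _ | _ = s≤s z≤n
    join : ∀ {t i} → t ∈ Y → c x t ≡ i → t ∈ S × t ∉ X × (∀ {u} → u ∈ X → c t u ≡ i)
    join {t} t∈ xt =
      let (t∈S , ¬st) = ∈-filter⁻ (¬? ∘ side?) {xs = S} t∈ in
      t∈S , (λ t∈X → ¬st (proj₂ (∈-filter⁻ side? {xs = S} t∈X))) , λ {u} u∈ →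
        let (u∈S , su) = ∈-filter⁻ side? {xs = S} u∈ in
        trans (c-sym t u) (trans (homogeneous u∈S t∈S su ¬st) xt)
    other : ∀ {t} → t ∈ Y → c x t ≢ a → c x t ≡ b
    other t∈ xt with ∈-filter⁻ (¬? ∘ side?) {xs = S} t∈
    ... | t∈S , ¬st with cross x∈ t∈S centre ¬st
    ...   | inj₁ e = contradiction e xt
    ...   | inj₂ e = e

  D² q : ℕ
  D² = (2 + p) ^ 2
  q = 2 ^ k

  module Step (σ : Vec Status k) (S : List V) (uS : Unique S) (win : AllWin σ S) (large : Φ σ ≤ length S)
              (ih : ∀ σ′ {X} → length X < length S → Unique X → AllWin σ′ X → Φ σ′ ≤ length X → Goal) where

    weight≤S : D² * totalWeight σ ≤ length S
    weight≤S = ≤-trans (m≤m+n _ (totalBudget σ)) large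

    smaller : ∀ {X t} → Unique X → (∀ {x} → x ∈ X → x ∈ S) → t ∈ S → t ∉ X → length X < length S
    smaller {X} {t} uX X⊆S t∈ t∉ = Unique-⊆⇒length≤ {xs = t ∷ X} (¬Any⇒All¬ X t∉ ∷ uX)
      λ { (here refl) → t∈ ; (there x∈) → X⊆S x∈ }

    -- Replacing the budgets by the error term `D² * q` leaves only weights to compare.
    bounded : ∀ σ′ {X} → length X < length S → Unique X → AllWin σ′ X →
      Goal ⊎ length X < D² * (totalWeight σ′ + q)
    bounded σ′ {X} X<S uX winX with Φ σ′ ≤? length X
    ... | yes Φ≤ = inj₁ (ih σ′ X<S uX winX Φ≤)
    ... | no Φ≰ = inj₂ (begin-strict
      length X                             <⟨ ≰⇒> Φ≰ ⟩
      D² * totalWeight σ′ + totalBudget σ′ ≤⟨ +-monoʳ-≤ _ (totalBudget≤ σ′ λ i → budget≤ (Vec.lookup σ′ i) (winX i)) ⟩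
      D² * totalWeight σ′ + k * (5 + p)    ≤⟨ +-monoʳ-≤ _ (budgets≤D²2^k k) ⟩
      D² * totalWeight σ′ + D² * q         ≡⟨ *-distribˡ-+ D² (totalWeight σ′) q ⟨
      D² * (totalWeight σ′ + q)            ∎)
      where open ≤-Reasoning

    demoted : Fin k → Vec Status k
    demoted i = σ [ i ]≔ demote (Vec.lookup σ i)

    coneBound : ∀ {X t i} → Big (Vec.lookup σ i) → Unique X → (∀ {x} → x ∈ X → x ∈ S) →
      t ∈ S → t ∉ X → (∀ {u} → u ∈ X → c t u ≡ i) →
      Goal ⊎ length X < D² * (totalWeight (demoted i) + q)
    coneBound {i = i} big uX X⊆S t∈ t∉ t-X = bounded (demoted i) (smaller uX X⊆S t∈ t∉) uX
      (AllWin-≔ σ (AllWin-⊆ σ X⊆S win) (Wins-demote big X⊆S t∈ t∉ t-X (win i)))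

    -- Seen from `T`, the vertex `x` of the module is the joined one, so the outer part is weakened
    -- as well.
    joinedBound : ∀ {X T x i} → Big (Vec.lookup σ i) → Unique T → x ∈ X → x ∈ S → Joined S X i T →
      Goal ⊎ length T < D² * (totalWeight (demoted i) + q)
    joinedBound {x = x} big uT x∈X x∈S join = coneBound big uT (proj₁ ∘ join) x∈S
      (λ x∈T → proj₁ (proj₂ (join x∈T)) x∈X)
      λ {u} u∈ → trans (c-sym x u) (proj₂ (proj₂ (join u∈)) x∈X)

    module Single {X T : List V} {x t : V} {i : Fin k} (uX : Unique X) (uT : Unique T) (x∈X : x ∈ X) (t∈T : t ∈ T)
                  (X⊆S : ∀ {y} → y ∈ X → y ∈ S) (join : Joined S X i T)
                  (count : length X + length T ≡ length S) where

      single-big : Big (Vec.lookup σ i) → Goal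
      single-big big
        with coneBound big uX X⊆S (proj₁ (join t∈T)) (proj₁ (proj₂ (join t∈T))) (proj₂ (proj₂ (join t∈T)))
           | joinedBound big uT x∈X (X⊆S x∈X) join
      ... | inj₁ g | _ = g
      ... | _ | inj₁ g = g
      ... | inj₂ X< | inj₂ T< = contradiction (begin-strict
        length S                           ≡⟨ count ⟨
        length X + length T                <⟨ +-mono-< X< T< ⟩
        D² * (w + q) + D² * (w + q)        ≡⟨ collapse D² w q ⟩
        D² * (2 * w + 2 * q)               ≤⟨ *-monoʳ-≤ D² (+-monoʳ-≤ (2 * w) (*-monoˡ-≤ q {2} {3} (s≤s (s≤s z≤n)))) ⟩
        D² * (2 * w + 3 * q)               ≤⟨ *-monoʳ-≤ D² (demote-gap σ i big) ⟩
        D² * totalWeight σ                 ≤⟨ weight≤S ⟩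
        length S                           ∎) (<-irrefl refl)
        where
        open ≤-Reasoning
        w = totalWeight (demoted i)
        collapse : ∀ d w q → d * (w + q) + d * (w + q) ≡ d * (2 * w + 2 * q)
        collapse = solve-∀

      single-path : ∀ {m} → Vec.lookup σ i ≡ path m → 3 + p ≤ length X → Goal
      single-path {m} e room with length T ≤? m
      ... | no T≰m = exhausted T≰m
        (Wins-shorten uX uT X⊆S join room (subst (λ s → Wins s i S) e (win i)))
      ... | yes T≤m = ih (σ [ i ]≔ path (m ∸ length T)) (smaller uX X⊆S (proj₁ (join t∈T)) (proj₁ (proj₂ (join t∈T)))) uX
        (AllWin-≔ σ (AllWin-⊆ σ X⊆S win)
          (Wins-shorten uX uT X⊆S join room (subst (λ s → Wins s i S) e (win i))))
        (+-cancelʳ-≤ (length T) _ _ (begin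
          Φ (σ [ i ]≔ path (m ∸ length T)) + length T ≡⟨ Φ-shorten σ i e T≤m ⟩
          Φ σ                                         ≤⟨ large ⟩
          length S                                    ≡⟨ count ⟨
          length X + length T                         ∎))
        where open ≤-Reasoning

    module TwoColours {a b : Fin k} (C : Cut S a b) where

      partsAt : ∀ {x} → x ∈ S → Parts S a b x
      partsAt = parts uS C

      module At {x : V} (x∈ : x ∈ S) where
        open Parts (partsAt x∈) public

        data Shape : Set where
          onlyA : ∀ {t} → t ∈ A → length X + length A ≡ length S → Shape
          onlyB : ∀ {t} → t ∈ B → length X + length B ≡ length S → Shape
          both  : ∀ {t t′} → t ∈ A → t′ ∈ B → Shape

        shape : Shape
        shape = go A B refl refl
          where
          -- The lists are matched through copies with equations, so that the fields of `Parts` keep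
          -- their types.
          go : ∀ A′ B′ → A′ ≡ A → B′ ≡ B → Shape
          go [] [] e f = contradiction proper (subst₂ (λ A B → ¬ 0 < length A + length B) e f λ ())
          go (t ∷ _) [] e f =
            onlyA (subst (t ∈_) e (here refl)) (trans (cong (length X +_) (sym (+-identityʳ (length A))))
              (subst (λ B → length X + (length A + length B) ≡ length S) (sym f) count))
          go [] (t ∷ _) e f =
            onlyB (subst (t ∈_) f (here refl)) (subst (λ A → length X + (length A + length B) ≡ length S) (sym e) count)
          go (t ∷ _) (t′ ∷ _) e f = both (subst (t ∈_) e (here refl)) (subst (t′ ∈_) f (here refl))

      big-big : ∀ {x} → x ∈ S → Big (Vec.lookup σ a) → Big (Vec.lookup σ b) → Goal
      big-big x∈ bigA bigB with At.shape x∈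
      ... | At.onlyA t∈ count′ = Single.single-big uX uA x∈X t∈ X⊆S joinA count′ bigA
        where open At x∈
      ... | At.onlyB t∈ count′ = Single.single-big uX uB x∈X t∈ X⊆S joinB count′ bigB
        where open At x∈
      ... | At.both {t} {t′} t∈ t′∈
        with joinedBound bigA (At.uA x∈) (At.x∈X x∈) x∈ (At.joinA x∈)
           | joinedBound bigB (At.uB x∈) (At.x∈X x∈) x∈ (At.joinB x∈)
           | bounded (demoted a [ b ]≔ demote (Vec.lookup σ b))
               (smaller uX X⊆S (proj₁ (joinA t∈)) (proj₁ (proj₂ (joinA t∈)))) uX
               (AllWin-≔ (demoted a) (AllWin-≔ σ (AllWin-⊆ σ X⊆S win)
                   (Wins-demote bigA X⊆S (proj₁ (joinA t∈)) (proj₁ (proj₂ (joinA t∈))) (proj₂ (proj₂ (joinA t∈))) (win a)))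
                 (Wins-demote bigB X⊆S (proj₁ (joinB t′∈)) (proj₁ (proj₂ (joinB t′∈))) (proj₂ (proj₂ (joinB t′∈))) (win b)))
        where open At x∈
      ...   | inj₁ g | _ | _ = g
      ...   | _ | inj₁ g | _ = g
      ...   | _ | _ | inj₁ g = g
      ...   | inj₂ A< | inj₂ B< | inj₂ X< = contradiction (begin-strict
        length S                                                    ≡⟨ count ⟨
        length X + (length A + length B)                            <⟨ +-mono-< X< (+-mono-< A< B<) ⟩
        D² * (wab + q) + (D² * (wa + q) + D² * (wb + q))            ≡⟨ collapse D² wab wa wb q ⟩
        D² * (wab + wa + wb + 3 * q)                                ≤⟨ *-monoʳ-≤ D² weights ⟩
        D² * totalWeight σ                                          ≤⟨ weight≤S ⟩
        length S                                                    ∎) (<-irrefl refl)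
        where
        open ≤-Reasoning
        open At x∈
        wa wb wab : ℕ
        wa = totalWeight (demoted a)
        wb = totalWeight (demoted b)
        wab = totalWeight (demoted a [ b ]≔ demote (Vec.lookup σ b))
        collapse : ∀ d x y z q → d * (x + q) + (d * (y + q) + d * (z + q)) ≡ d * (x + y + z + 3 * q)
        collapse = solve-∀
        unchanged : Vec.lookup (demoted a) b ≡ Vec.lookup σ b
        unchanged = lookup∘update′ (distinct t′∈ ∘ sym) σ _
        gap : 2 * wab + 3 * q ≤ wa
        gap = subst (λ s → 2 * totalWeight (demoted a [ b ]≔ demote s) + 3 * q ≤ wa) unchanged
          (demote-gap (demoted a) b (subst Big (sym unchanged) bigB))
        weights : wab + wa + wb + 3 * q ≤ totalWeight σ
        -- After adding a further `3 * wab`, the gap for `b` bounds `wab` and the error terms by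
        -- `wa`. What remains is `wa` twice and `wb` once, each at most a third of the original
        -- weight.
        weights = *-cancelˡ-≤ 3 (begin
          3 * (wab + wa + wb + 3 * q)                     ≤⟨ m≤m+n _ (3 * wab) ⟩
          3 * (wab + wa + wb + 3 * q) + 3 * wab           ≡⟨ regroup wab wa wb q ⟩
          3 * (2 * wab + 3 * q) + (3 * wa + 3 * wb)       ≤⟨ +-mono-≤ (≤-trans (*-monoʳ-≤ 3 gap) (demote-third σ a bigA))
                                                              (+-mono-≤ (demote-third σ a bigA) (demote-third σ b bigB)) ⟩
          totalWeight σ + (totalWeight σ + totalWeight σ) ≡⟨ triple (totalWeight σ) ⟩
          3 * totalWeight σ                               ∎)
          where
          regroup : ∀ x y z q → 3 * (x + y + z + 3 * q) + 3 * x ≡ 3 * (2 * x + 3 * q) + (3 * y + 3 * z)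
          regroup = solve-∀
          triple : ∀ x → x + (x + x) ≡ 3 * x
          triple = solve-∀

      6+p≤D²q : 6 + p ≤ D² * q
      -- The colour `a` witnesses that `k` is positive.
      6+p≤D²q = go k a
        where
        go : ∀ k → Fin k → 6 + p ≤ D² * 2 ^ k
        go (suc k) _ = 6+p≤D²2^k k

      -- If every vertex has many neighbours in colour `b`, a path is found greedily. Otherwise the
      -- module is taken at a vertex `y` of small degree in `b`; since `y` is joined to all of `B`
      -- in that colour, `B` is small.
      big-path : ∀ {x m} → x ∈ S → Big (Vec.lookup σ a) → Vec.lookup σ b ≡ path m → Goal
      big-path x∈ bigA eb with search (λ x → length (filter (λ y → c x y Fin.≟ b) S) <? 4 + p) S
      ... | inj₂ none = winPath (subst (λ s → Wins s b S) eb (win b))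
              (greedyPath uS x∈ (λ y∈ → ≮⇒≥ (none y∈)) (4 + p) ≤-refl)
      ... | inj₁ (y , y∈ , deg) = go shape
        where
        open ≤-Reasoning
        open At y∈
        B≤ : length B ≤ 6 + p
        B≤ = ≤-trans (Unique-⊆⇒length≤ uB λ {t} t∈ → ∈-filter⁺ (λ z → c y z Fin.≟ b) (proj₁ (joinB t∈))
                       (trans (c-sym y t) (proj₂ (proj₂ (joinB t∈)) x∈X)))
               (≤-trans (<⇒≤ deg) (m≤n+m (4 + p) 2))
        w = totalWeight (demoted a)
        collapse : ∀ d w q → d * (w + q) + (d * (w + q) + d * q) ≡ d * (2 * w + 3 * q)
        collapse = solve-∀

        go : Shape → Goal
        go (onlyA t∈ count′) = Single.single-big uX uA x∈X t∈ X⊆S joinA count′ bigA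
        -- Here `S` has at least `2(6 + p)` vertices and `B` at most `6 + p`, so the module is large
        -- enough for the path in colour `b` to be shortened.
        go (onlyB t∈ count′) = Single.single-path uX uB x∈X t∈ X⊆S joinB count′ eb
          (≤-trans (m≤n+m (3 + p) 3) (+-cancelʳ-≤ (6 + p) _ _ (begin
            6 + p + (6 + p)      ≤⟨ +-mono-≤ 6+p≤D²q 6+p≤D²q ⟩
            D² * q + D² * q      ≤⟨ m≤m+n _ (D² * (2 * w + q)) ⟩
            D² * q + D² * q + D² * (2 * w + q) ≡⟨ regroup D² w q ⟩
            D² * (2 * w + 3 * q) ≤⟨ *-monoʳ-≤ D² (demote-gap σ a bigA) ⟩
            D² * totalWeight σ   ≤⟨ weight≤S ⟩
            length S             ≡⟨ count′ ⟨
            length X + length B  ≤⟨ +-monoʳ-≤ (length X) B≤ ⟩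
            length X + (6 + p)   ∎)))
          where
          regroup : ∀ d w q → d * q + d * q + d * (2 * w + q) ≡ d * (2 * w + 3 * q)
          regroup = solve-∀
        go (both t∈ t′∈)
          with coneBound bigA uX X⊆S (proj₁ (joinA t∈)) (proj₁ (proj₂ (joinA t∈))) (proj₂ (proj₂ (joinA t∈)))
             | joinedBound bigA uA x∈X y∈ joinA
        ... | inj₁ g | _ = g
        ... | _ | inj₁ g = g
        -- `X` and `A` use two of the error terms in `demote-gap`; the third one pays for `B`.
        ... | inj₂ X< | inj₂ A< = contradiction (begin-strict
          length S                                  ≡⟨ count ⟨
          length X + (length A + length B)          <⟨ +-mono-<-≤ X< (+-mono-≤ (<⇒≤ A<) (≤-trans B≤ 6+p≤D²q)) ⟩
          D² * (w + q) + (D² * (w + q) + D² * q)    ≡⟨ collapse D² w q ⟩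
          D² * (2 * w + 3 * q)                      ≤⟨ *-monoʳ-≤ D² (demote-gap σ a bigA) ⟩
          D² * totalWeight σ                        ≤⟨ weight≤S ⟩
          length S                                  ∎) (<-irrefl refl)

      module PathPath {m m′ : ℕ} (ea : Vec.lookup σ a ≡ path m) (eb : Vec.lookup σ b ≡ path m′) where

        winA : Wins (path m) a S
        winA = subst (λ s → Wins s a S) ea (win a)
        winB : Wins (path m′) b S
        winB = subst (λ s → Wins s b S) eb (win b)

        large-module : ∀ {x} (x∈ : x ∈ S) → 3 + p ≤ length (At.X x∈) → Goal
        large-module x∈ room with At.shape x∈
        ... | At.onlyA t∈ count′ = Single.single-path uX uA x∈X t∈ X⊆S joinA count′ ea room
          where open At x∈
        ... | At.onlyB t∈ count′ = Single.single-path uX uB x∈X t∈ X⊆S joinB count′ eb room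
          where open At x∈
        ... | At.both t∈ t′∈ with length (At.A x∈) ≤? m | length (At.B x∈) ≤? m′
        ...   | no A≰ | _ = exhausted A≰ (Wins-shorten uX uA X⊆S joinA room winA)
          where open At x∈
        ...   | _ | no B≰ = exhausted B≰ (Wins-shorten uX uB X⊆S joinB room winB)
          where open At x∈
        -- Both outer parts are charged to the budgets, so the potential drops by exactly the number
        -- of vertices removed.
        ...   | yes A≤ | yes B≤ =
          ih σ₂ (smaller uX X⊆S (proj₁ (joinA t∈)) (proj₁ (proj₂ (joinA t∈)))) uX
            (AllWin-≔ σ₁ (AllWin-≔ σ (AllWin-⊆ σ X⊆S win) (Wins-shorten uX uA X⊆S joinA room winA))
              (Wins-shorten uX uB X⊆S joinB room winB))
            (+-cancelʳ-≤ (length A + length B) _ _ (begin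
              Φ σ₂ + (length A + length B)     ≡⟨ cong (Φ σ₂ +_) (+-comm (length A) (length B)) ⟩
              Φ σ₂ + (length B + length A)     ≡⟨ +-assoc (Φ σ₂) (length B) (length A) ⟨
              Φ σ₂ + length B + length A       ≡⟨ cong (_+ length A) (Φ-shorten σ₁ b
                                                    (trans (lookup∘update′ (distinct t′∈ ∘ sym) σ _) eb) B≤) ⟩
              Φ σ₁ + length A                  ≡⟨ Φ-shorten σ a ea A≤ ⟩
              Φ σ                              ≤⟨ large ⟩
              length S                         ≡⟨ count ⟨
              length X + (length A + length B) ∎))
          where
          open At x∈
          open ≤-Reasoning
          σ₁ σ₂ : Vec Status k
          σ₁ = σ [ a ]≔ path (m ∸ length A)
          σ₂ = σ₁ [ b ]≔ path (m′ ∸ length B)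

        -- Both factors of `(2 + p) ^ 2` are used here: one is lost to the size of the modules, and
        -- the other makes the transversal long enough for a path on `4 + p` vertices.
        small-modules : (∀ {x} → x ∈ S → ∃ λ X → length X ≤ 2 + p × x ∈ X ×
          (∀ {y} → y ∈ S → ¬ (c x y ≡ a ⊎ c x y ≡ b) → y ∈ X)) → Goal
        small-modules small with transversal small S uS id (<-wellFounded _)
        ... | L , uL , L⊆S , two , long = go (a Fin.≟ b)
          where
          open ≤-Reasoning
          L≥ : q * (2 + p) ≤ length L
          L≥ = *-cancelʳ-≤ _ _ (2 + p) (begin
            q * (2 + p) * (2 + p)  ≡⟨ reorder q p ⟩
            D² * q                 ≤⟨ *-monoʳ-≤ D² (2^k≤totalWeight σ) ⟩
            D² * totalWeight σ     ≤⟨ weight≤S ⟩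
            length S               ≤⟨ long ⟩
            length L * (2 + p)     ∎)
            where
            reorder : ∀ q p → q * (2 + p) * (2 + p) ≡ (2 + p) * ((2 + p) * 1) * q
            reorder = solve-∀

          2≤q : 2 ≤ q
          2≤q = pos k a
            where
            pos : ∀ k → Fin k → 2 ≤ 2 ^ k
            pos (suc k) _ = ≤-trans (m≤m*n 2 (suc k)) (2n≤2^n k)

          -- Distinct colours force `k ≥ 2`. This doubles the transversal and makes up for the
          -- factor two lost in `ramseyPath`.
          4≤q : a ≢ b → 4 ≤ q
          4≤q = pos k a b
            where
            pos : ∀ k → (a b : Fin k) → a ≢ b → 4 ≤ 2 ^ k
            pos (suc zero) zero zero a≢b = contradiction refl a≢b
            pos (suc (suc k)) _ _ _ = ≤-trans (*-monoʳ-≤ 2 (s≤s (s≤s z≤n))) (2n≤2^n (suc k))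

          go : Dec (a ≡ b) → Goal
          go (yes refl) = winPath winA (shorten (begin
            4 + p         ≤⟨ +-monoʳ-≤ 4 (m≤n*m p 2) ⟩
            4 + 2 * p     ≡⟨ *-distribˡ-+ 2 2 p ⟨
            2 * (2 + p)   ≤⟨ *-monoˡ-≤ (2 + p) 2≤q ⟩
            q * (2 + p)   ≤⟨ L≥ ⟩
            length L      ∎) (monoPath uL L⊆S two))
          go (no a≢b) = [ winPath winA , winPath winB ]′ (ramseyPath uL L⊆S two (begin
            4 + p + (4 + p)                  ≤⟨ m≤m+n _ (2 * p) ⟩
            4 + p + (4 + p) + 2 * p          ≡⟨ regroup p ⟩
            4 * (2 + p)                      ≤⟨ *-monoˡ-≤ (2 + p) (4≤q a≢b) ⟩
            q * (2 + p)                      ≤⟨ L≥ ⟩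
            length L                         ≤⟨ n≤1+n _ ⟩
            suc (length L)                   ∎))
            where
            regroup : ∀ p → 4 + p + (4 + p) + 2 * p ≡ 4 * (2 + p)
            regroup = solve-∀

        path-path : Goal
        path-path with collect S (λ x∈ → [ inj₁ ∘ large-module x∈ , inj₂ ∘ small-part x∈ ]′ (≤-<-connex (3 + p) (length (At.X x∈))))
          where
          small-part : ∀ {x} (x∈ : x ∈ S) → length (At.X x∈) < 3 + p →
            ∃ λ X → length X ≤ 2 + p × x ∈ X × (∀ {y} → y ∈ S → ¬ (c x y ≡ a ⊎ c x y ≡ b) → y ∈ X)
          small-part x∈ (s≤s X≤) = At.X x∈ , X≤ , At.x∈X x∈ , At.rest x∈
        ... | inj₁ g = g
        ... | inj₂ small = small-modules small

    step : Goal
    step with gallaiCut uS two≤S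
      where
      two≤S : 2 ≤ length S
      two≤S = ≤-trans (≤-trans (m≤m+n 2 _) (≤-reflexive (expand p)))
        (≤-trans (*-mono-≤ (≤-refl {D²}) (≤-trans (≤-trans (s≤s z≤n) (n<2^n k)) (2^k≤totalWeight σ))) weight≤S)
        where
        expand : ∀ p → 2 + (2 + 4 * p + p * p) ≡ (2 + p) * ((2 + p) * 1) * 1
        expand = solve-∀
    ... | a , b , C with big? (Vec.lookup σ a) | big? (Vec.lookup σ b) | proj₁ (proj₂ (Cut.inner C))
    ...   | inj₁ bigA | inj₁ bigB | x∈ = TwoColours.big-big C x∈ bigA bigB
    ...   | inj₁ bigA | inj₂ (_ , eb) | x∈ = TwoColours.big-path C x∈ bigA eb
    -- The two colours of a cut play symmetric roles, so this case is the previous one with the cut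
    -- swapped.
    ...   | inj₂ (_ , ea) | inj₁ bigB | x∈ = TwoColours.big-path (swap C) x∈ bigB ea
    ...   | inj₂ (_ , ea) | inj₂ (_ , eb) | _ = TwoColours.PathPath.path-path C ea eb

  solve : ∀ σ {S} → Acc _<_ (length S) → Unique S → AllWin σ S → Φ σ ≤ length S → Goal
  solve σ {S} (acc rs) uS win large =
    Step.step σ S uS win large λ σ′ X<S uX winX → solve σ′ (rs X<S) uX winX

-- The initial state.

module Initial (p r s t : ℕ) where

  open Potential p

  totalWeight-++ : ∀ {m n} (σ : Vec Status m) (τ : Vec Status n) →
    totalWeight (σ Vec.++ τ) ≡ totalWeight σ * totalWeight τ
  totalWeight-++ []      τ = sym (+-identityʳ _)
  totalWeight-++ (x ∷ σ) τ =
    trans (cong (weight x *_) (totalWeight-++ σ τ)) (sym (*-assoc (weight x) _ _))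

  totalWeight-replicate : ∀ n x → totalWeight (Vec.replicate n x) ≡ weight x ^ n
  totalWeight-replicate zero    x = refl
  totalWeight-replicate (suc n) x = cong (weight x *_) (totalWeight-replicate n x)

  wheels : Vec Status r
  wheels = Vec.replicate r wheel

  cycles : Vec Status s
  cycles = Vec.replicate s cycle

  paths : Vec Status t
  paths = Vec.replicate t (path (4 + p))

  wheels-cycles : Vec Status (r + s)
  wheels-cycles = wheels Vec.++ cycles

  initial : Vec Status (r + s + t)
  initial = wheels-cycles Vec.++ paths

  totalWeight-initial : totalWeight initial ≡ 30 ^ r * 10 ^ s * 2 ^ t
  totalWeight-initial = trans (totalWeight-++ wheels-cycles paths)
    (cong₂ _*_ (trans (totalWeight-++ wheels cycles)
                  (cong₂ _*_ (totalWeight-replicate r wheel) (totalWeight-replicate s cycle)))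
               (totalWeight-replicate t (path (4 + p))))

  -- A view of the status at `i` that carries the inequalities demanded by `Contains`.
  data Initially (i : Fin (r + s + t)) : Status → Set where
    isWheel : toℕ i < r → Initially i wheel
    isCycle : r ≤ toℕ i → toℕ i < r + s → Initially i cycle
    isPath  : r + s ≤ toℕ i → Initially i (path (4 + p))

  initially : ∀ i → Initially i (Vec.lookup initial i)
  initially i with toℕ i <? r + s
  ... | no i≮ = subst (Initially i)
          (sym (trans (lookup-++-≥ wheels-cycles paths i (≮⇒≥ i≮)) (lookup-replicate (reduce≥ i (≮⇒≥ i≮)) _)))
          (isPath (≮⇒≥ i≮))
  ... | yes i< with toℕ (fromℕ< i<) <? r
  ...   | yes j< = subst (Initially i)
            (sym (trans (lookup-++-< wheels-cycles paths i i<)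
              (trans (lookup-++-< wheels cycles (fromℕ< i<) j<) (lookup-replicate (fromℕ< j<) wheel))))
            (isWheel (subst (_< r) (Fin.toℕ-fromℕ< i<) j<))
  ...   | no j≮ = subst (Initially i)
            (sym (trans (lookup-++-< wheels-cycles paths i i<)
              (trans (lookup-++-≥ wheels cycles (fromℕ< i<) (≮⇒≥ j≮))
                (lookup-replicate (reduce≥ (fromℕ< i<) (≮⇒≥ j≮)) cycle))))
            (isCycle (subst (r ≤_) (Fin.toℕ-fromℕ< i<) (≮⇒≥ j≮)) i<)

-- The upper bound for the Gallai-Ramsey number.

rainbow? : ∀ {N k} (c : Fin N → Fin N → Fin k) → Dec (RainbowTriangle c)
rainbow? c = Fin.any? λ x → Fin.any? λ y → Fin.any? λ z →
  ¬? (x Fin.≟ y) ×-dec ¬? (y Fin.≟ z) ×-dec ¬? (x Fin.≟ z) ×-dec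
  ¬? (c x y Fin.≟ c y z) ×-dec ¬? (c y z Fin.≟ c x z) ×-dec ¬? (c x y Fin.≟ c x z)

theorem10 : (k n r s t : ℕ) → 1 ≤ k → 6 ≤ n → r + s + t ≡ k →
    (N : ℕ) → (n ∸ 4) ^ 2 * 30 ^ r * 10 ^ s * 2 ^ t + k * (n ∸ 1) ≤ N →
    GRProperty k n r s N
theorem10 k n r s t _ 6≤n refl N bound (c , c-sym) with rainbow? c
... | yes rainbow = inj₁ rainbow
... | no ¬rainbow with m≤n⇒∃[o]m+o≡n 6≤n
...   | p , refl = inj₂ (solve initial (<-wellFounded _) (Uniq.allFin⁺ N) win (begin
        (2 + p) ^ 2 * totalWeight initial + totalBudget initial
          ≡⟨ cong (λ w → (2 + p) ^ 2 * w + totalBudget initial) totalWeight-initial ⟩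
        (2 + p) ^ 2 * (30 ^ r * 10 ^ s * 2 ^ t) + totalBudget initial
          ≡⟨ cong (_+ totalBudget initial) (reassociate ((2 + p) ^ 2) (30 ^ r) (10 ^ s) (2 ^ t)) ⟩
        (2 + p) ^ 2 * 30 ^ r * 10 ^ s * 2 ^ t + totalBudget initial
          -- Each of the `k` initial budgets is at most `n - 1`, which gives the linear term of the
          -- bound.
          ≤⟨ +-monoʳ-≤ _ (totalBudget≤ initial λ i → budget≤ (Vec.lookup initial i) (win i)) ⟩
        (2 + p) ^ 2 * 30 ^ r * 10 ^ s * 2 ^ t + (r + s + t) * (5 + p)
          ≤⟨ bound ⟩
        N
          ≡⟨ length-tabulate id ⟨
        length (allFin N) ∎))
  where
  Goal : Set
  Goal = ∃ λ i → Contains c (6 + p) r s i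
  open Potential p
  open Initial p r s t
  open Main c c-sym ¬rainbow p Goal
  open Copies c c-sym
  open ≤-Reasoning

  reassociate : ∀ a b c d → a * (b * c * d) ≡ a * b * c * d
  reassociate = solve-∀

  win : AllWin initial (allFin N)
  win i with Vec.lookup initial i | initially i
  ... | _ | isWheel i<     = λ (H , _) → i , inj₁ (i< , H)
  ... | _ | isCycle i≥ i<  = λ (H , _) → i , inj₂ (inj₁ ((i≥ , i<) , H))
  ... | _ | isPath i≥      = ≤-refl , λ P → i , inj₂ (inj₂ (i≥ , proj₁ (pathCopy P)))
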